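{- If a rule set is $\mathrm{RPC}_s$, then it never-terminates.
   Context: Setting (restricted disjunctive chase). Rules $\rho$: $\forall \vec w,\vec x.[\beta\to \bigvee_{i=1}^n \exists \vec y_i.\eta_i]$ with frontier $\vec x$, $\mathrm{branching}(\rho)=n$; datalog = $n=1$ without existential variables; skolemization $\mathrm{sk}(\rho)$ replaces $y\in\vec y_i$ by $f^\rho_{i,y}(\vec x)$. Trigger $\lambda=(\rho,\sigma)$: loaded for $F$ if $\mathrm{body}(\rho)\sigma\subseteq F$; obsolete for $F$ if some extension $\sigma'$ of $\sigma$ gives $\mathrm{head}_i(\rho)\sigma'\subseteq F$; $\mathrm{out}_i(\lambda)=\mathrm{head}_i(\mathrm{sk}(\rho))\sigma$; $\mathcal{R}$-triggers use rules of $\mathcal{R}$ and substitutions into terms over $\mathrm{sk}(\mathcal{R})$. Chase trees of $(\mathcal{R},D)$ are rooted at $D$, apply loaded non-obsolete $\mathcal{R}$-triggers (datalog first) with one child per disjunct, leaves satisfy all rules, fairness holds; $\mathcal{R}$ never-terminates if some KB with $\mathcal{R}$ has no finite chase tree. A head-choice $hc$ picks a disjunct per rule; $\mathrm{out}_{hc}(\lambda)=\mathrm{out}_{hc(\rho)}(\lambda)$. Birth facts: $\mathrm{birth}(c)=\emptyset$; $\mathrm{birth}(f^\psi_{i,v}(\vec s))=\mathrm{out}_i((\psi,\tau))\cup\bigcup_s\mathrm{birth}(s)$ with $\tau$ mapping $\mathrm{frontier}(\psi)$ to $\vec s$; $\mathrm{birth}((\psi,\tau))=\bigcup_{x\in\mathrm{frontier}(\psi)}\mathrm{birth}(\tau(x))$;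 $\mathrm{skel}(\lambda)$ = terms of $\mathrm{birth}(\lambda)$ plus constants assigned to frontier variables. $h^{uc}_\lambda$ maps functional terms $f(\vec t)\notin\mathrm{skel}(\lambda)$ to fresh constants $c_f$, terms of $\mathrm{skel}(\lambda)$ and the $c_f$ to themselves, others to a special constant $\star$. $\mathcal{O}(\mathcal{R},hc,\lambda,h)$ is the minimal fact set containing all facts over predicates of $\mathcal{R}$ and constants in $\mathrm{skel}(\lambda)\cup\{\star\}$, including $\mathrm{birth}(\lambda)$, and including $h(\mathrm{out}_{hc}(\lambda'))$ for each $\mathcal{R}$-trigger $\lambda'$ loaded for it with $\mathrm{out}_{hc}(\lambda')\neq\mathrm{out}_{hc}(\lambda)$. $\lambda$ is uc-unblockable for $\mathcal{R}$ and $hc$ if its rule is datalog or it is not obsolete for $\mathcal{O}(\mathcal{R},hc,\lambda,h^{uc}_\lambda)$. $D_\rho=\mathrm{body}(\rho)\sigma_{uc}$ with $\sigma_{uc}$ mapping each variable $x$ to a fresh constant $c_x$. A term is cyclic if it has a subterm $f(\vec s)$ with $f$ occurring in $\vec s$; $\rho$-cyclic if it is $f(\vec s)$ with $f$ from $\mathrm{sk}(\rho)$ occurring in $\vec s$. $\mathrm{RPC}(\mathcal{R},hc,\rho)$ is the (least) fact set including $D_\rho$, $\mathrm{out}_{hc}((\rho,\sigma_{uc}))$, and $\mathrm{out}_{hc}(\lambda)$ for every $\mathcal{R}$-trigger $\lambda=(\psi,\tau)$ with no cyclic term in the range of $\tau$, loaded for $\mathrm{RPC}(\mathcal{R},hc,\rho)$,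 uc-unblockable for $\mathcal{R}$ and $hc$, and with $\tau$ injective if $\psi=\rho$. For $i\ge1$, $hc_i$ is the head-choice with $hc_i(\rho)=i$ if $i\le\mathrm{branching}(\rho)$ and $hc_i(\rho)=\mathrm{branching}(\rho)$ otherwise; $\mathrm{branching}(\mathcal{R})=\max_{\rho\in\mathcal{R}}\mathrm{branching}(\rho)$. $\mathcal{R}$ is $\mathrm{RPC}_s$ if there are $1\le i\le\mathrm{branching}(\mathcal{R})$, a (generating) $\rho\in\mathcal{R}$, and a $\rho$-cyclic term occurring in $\mathrm{RPC}(\mathcal{R},hc_i,\rho)$. -}

module Defs where

open import Data.Nat using (ℕ; zero; suc; _≟_; _⊔_; _∸_; _≤_)
open import Data.Fin using (Fin; toℕ)
import Data.Fin as Fin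
open import Data.List using (List; []; _∷_; map; concatMap; filter; deduplicate; foldr; lookup; length; _++_)
open import Data.List.NonEmpty using (List⁺; _∷_; toList)
import Data.List.NonEmpty as L⁺
open import Data.List.Membership.Propositional using (_∈_; _∉_)
open import Data.List.Membership.DecPropositional _≟_ using (_∈?_)
open import Data.List.Relation.Binary.Pointwise using (Pointwise)
open import Data.Product using (Σ; ∃; ∃-syntax; _×_; _,_)
open import Data.Sum using (_⊎_)
open import Data.Empty using (⊥)
open import Relation.Nullary using (¬_; yes; no)
open import Relation.Binary.PropositionalEquality using (_≡_)

Var : Set
Var = ℕ

-- A predicate is identified by its name together with its arity
-- (= the length of the argument list).
record Atom (T : Set) : Set where
  constructor atom
  field
    pred : ℕ
    args : List T
open Atom public

mapAtom : {A B : Set} → (A → B) → Atom A → Atom B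
mapAtom f (atom p ts) = atom p (map f ts)

SamePred : {A B : Set} → Atom A → Atom B → Set
SamePred a b = (pred a ≡ pred b) × (length (args a) ≡ length (args b))

-- ∀ w⃗ x⃗. β → ⋁_{i=1}^n ∃ y⃗_i. η_i   (n ≥ 1, constant-free)
record Rule : Set where
  constructor rule
  field
    body  : List (Atom Var)
    heads : List⁺ (List (Atom Var))
open Rule public

branching : Rule → ℕ
branching ρ = L⁺.length (heads ρ)

disjunct : (ρ : Rule) → Fin (branching ρ) → List (Atom Var)
disjunct ρ i = lookup (toList (heads ρ)) i

atomsVars : List (Atom Var) → List Var
atomsVars = concatMap args

bodyVars : Rule → List Var
bodyVars ρ = atomsVars (body ρ)

allHeadVars : Rule → List Var
allHeadVars ρ = concatMap atomsVars (toList (heads ρ))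

frontier : Rule → List Var
frontier ρ = deduplicate _≟_ (filter (_∈? allHeadVars ρ) (bodyVars ρ))

Datalog : Rule → Set
Datalog ρ = (branching ρ ≡ 1) × (∀ x → x ∈ allHeadVars ρ → x ∈ bodyVars ρ)

record FSym : Set where
  constructor fsym
  field
    frule : Rule
    fidx  : Fin (branching frule)
    fvar  : Var
open FSym public

data Const : Set where
  con  : ℕ → Const
  cvar : Var → Const       -- c_x (fresh constants used for σ_uc)
  cfun : FSym → Const      -- c_f (fresh constants used by h^uc)
  star : Const

data GTerm : Set where
  const : Const → GTerm
  app   : FSym → List GTerm → GTerm

Fact : Set
Fact = Atom GTerm

FactSet : Set₁
FactSet = Fact → Set

listSet : List Fact → FactSet
listSet F a = a ∈ F

_⊆ˡ_ : List Fact → FactSet → Set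
A ⊆ˡ F = ∀ a → a ∈ A → F a

_≐_ : List Fact → List Fact → Set
A ≐ B = ∀ a → (a ∈ A → a ∈ B) × (a ∈ B → a ∈ A)

IsConst : GTerm → Set
IsConst t = ∃[ c ] t ≡ const c

OccursIn : GTerm → FactSet → Set
OccursIn t F = ∃[ a ] F a × t ∈ args a

Subst : Set
Subst = Var → GTerm

record Trigger : Set where
  constructor trig
  field
    trule : Rule
    tsub  : Subst
open Trigger public

skSubst : (ρ : Rule) → Fin (branching ρ) → Subst → Subst
skSubst ρ i σ v with v ∈? bodyVars ρ
... | yes _ = σ v
... | no  _ = app (fsym ρ i v) (map σ (frontier ρ))

out : (λ₀ : Trigger) → Fin (branching (trule λ₀)) → List Fact
out (trig ρ σ) i = map (mapAtom (skSubst ρ i σ)) (disjunct ρ i)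

HeadChoice : Set
HeadChoice = (ρ : Rule) → Fin (branching ρ)

outHC : HeadChoice → Trigger → List Fact
outHC hc λ₀ = out λ₀ (hc (trule λ₀))

Loaded : FactSet → Trigger → Set
Loaded F (trig ρ σ) = ∀ a → a ∈ body ρ → F (mapAtom σ a)

Obsolete : FactSet → Trigger → Set
Obsolete F (trig ρ σ) =
  ∃[ i ] ∃[ σ' ] ((∀ x → x ∈ bodyVars ρ → σ' x ≡ σ x)
                 × (∀ a → a ∈ disjunct ρ i → F (mapAtom σ' a)))

data OverSk (R : List Rule) : GTerm → Set where
  oconst : ∀ {c} → OverSk R (const c)
  oapp   : ∀ {f ts} → frule f ∈ R
         → fvar f ∈ atomsVars (disjunct (frule f) (fidx f))
         → fvar f ∉ bodyVars (frule f)
         → length ts ≡ length (frontier (frule f))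
         → (∀ t → t ∈ ts → OverSk R t)
         → OverSk R (app f ts)

RTrigger : List Rule → Trigger → Set
RTrigger R (trig ρ σ) = (ρ ∈ R) × (∀ x → x ∈ bodyVars ρ → OverSk R (σ x))

Database : Set
Database = List Fact

IsDatabase : Database → Set
IsDatabase D = ∀ a → a ∈ D → ∀ t → t ∈ args a → IsConst t

data FiniteChaseTree (R : List Rule) : List Fact → Set where
  leaf : ∀ {F} → (∀ λ₀ → trule λ₀ ∈ R → Loaded (listSet F) λ₀ → Obsolete (listSet F) λ₀)
       → FiniteChaseTree R F
  node : ∀ {F} (λ₀ : Trigger)
       → RTrigger R λ₀
       → Loaded (listSet F) λ₀
       → ¬ Obsolete (listSet F) λ₀
       → (¬ Datalog (trule λ₀) →
            ∀ λ₁ → RTrigger R λ₁ → Datalog (trule λ₁) → Loaded (listSet F) λ₁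
                 → Obsolete (listSet F) λ₁)
       → ((i : Fin (branching (trule λ₀))) → FiniteChaseTree R (F ++ out λ₀ i))
       → FiniteChaseTree R F

NeverTerminates : List Rule → Set
NeverTerminates R = ∃[ D ] IsDatabase D × ¬ FiniteChaseTree R D

assign : List Var → List GTerm → Subst
assign (x ∷ xs) (s ∷ ss) y with y ≟ x
... | yes _ = s
... | no  _ = assign xs ss y
assign _ _ y = const star

fTrigger : FSym → List GTerm → Trigger
fTrigger f ss = trig (frule f) (assign (frontier (frule f)) ss)

data Birth : GTerm → Fact → Set where
  own : ∀ {f ss a} → a ∈ out (fTrigger f ss) (fidx f) → Birth (app f ss) a
  sub : ∀ {f ss s a} → s ∈ ss → Birth s a → Birth (app f ss) a

BirthT : Trigger → FactSet
BirthT (trig ψ τ) a = ∃[ x ] x ∈ frontier ψ × Birth (τ x) a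

Skel : Trigger → GTerm → Set
Skel λ₀ t = (∃[ a ] BirthT λ₀ a × t ∈ args a)
          ⊎ (∃[ x ] x ∈ frontier (trule λ₀) × tsub λ₀ x ≡ t × IsConst t)

-- h^uc_λ as a (functional) relation on terms
data Huc (λ₀ : Trigger) : GTerm → GTerm → Set where
  hskel : ∀ {t} → Skel λ₀ t → Huc λ₀ t t
  hfun  : ∀ {f ts} → ¬ Skel λ₀ (app f ts) → Huc λ₀ (app f ts) (const (cfun f))
  hcf   : ∀ {f} → ¬ Skel λ₀ (const (cfun f)) → Huc λ₀ (const (cfun f)) (const (cfun f))
  hstar : ∀ {c} → ¬ Skel λ₀ (const c) → (∀ f → ¬ (c ≡ cfun f)) → Huc λ₀ (const c) (const star)

PredOf : List Rule → Fact → Set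
PredOf R a = ∃[ ρ ] ρ ∈ R × ∃[ b ] (b ∈ body ρ ⊎ b ∈ allHeadAtoms ρ) × SamePred b a
  where
    allHeadAtoms : Rule → List (Atom Var)
    allHeadAtoms ρ = concatMap (λ η → η) (toList (heads ρ))

HFact : (GTerm → GTerm → Set) → Fact → Fact → Set
HFact h a b = (pred a ≡ pred b) × Pointwise h (args a) (args b)

data O (R : List Rule) (hc : HeadChoice) (λ₀ : Trigger) (h : GTerm → GTerm → Set) : Fact → Set where
  oall   : ∀ {a} → PredOf R a
         → (∀ t → t ∈ args a → ∃[ c ] t ≡ const c × (Skel λ₀ (const c) ⊎ c ≡ star))
         → O R hc λ₀ h a
  obirth : ∀ {a} → BirthT λ₀ a → O R hc λ₀ h a
  oout   : ∀ {a b} (λ₁ : Trigger) → RTrigger R λ₁ → Loaded (O R hc λ₀ h) λ₁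
         → ¬ (outHC hc λ₁ ≐ outHC hc λ₀)
         → a ∈ outHC hc λ₁ → HFact h a b → O R hc λ₀ h b

UcUnblockable : List Rule → HeadChoice → Trigger → Set
UcUnblockable R hc λ₀ = Datalog (trule λ₀) ⊎ ¬ Obsolete (O R hc λ₀ (Huc λ₀)) λ₀

data Occ (f : FSym) : GTerm → Set where
  ohere  : ∀ {ts} → Occ f (app f ts)
  odeep  : ∀ {g ts t} → t ∈ ts → Occ f t → Occ f (app g ts)

data SubTerm (u : GTerm) : GTerm → Set where
  srefl : SubTerm u u
  sdeep : ∀ {g ts t} → t ∈ ts → SubTerm u t → SubTerm u (app g ts)

Cyclic : GTerm → Set
Cyclic t = ∃[ f ] ∃[ ss ] SubTerm (app f ss) t × ∃[ s ] s ∈ ss × Occ f s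

RhoCyclic : Rule → GTerm → Set
RhoCyclic ρ t = ∃[ f ] ∃[ ss ] t ≡ app f ss × frule f ≡ ρ × ∃[ s ] s ∈ ss × Occ f s

σuc : Subst
σuc x = const (cvar x)

Dρ : Rule → List Fact
Dρ ρ = map (mapAtom σuc) (body ρ)

InjectiveOn : List Var → Subst → Set
InjectiveOn xs σ = ∀ x y → x ∈ xs → y ∈ xs → σ x ≡ σ y → x ≡ y

data RPC (R : List Rule) (hc : HeadChoice) (ρ : Rule) : Fact → Set where
  rbase : ∀ {a} → a ∈ Dρ ρ → RPC R hc ρ a
  rinit : ∀ {a} → a ∈ outHC hc (trig ρ σuc) → RPC R hc ρ a
  rstep : ∀ {a} (λ₁ : Trigger) → RTrigger R λ₁
        → (∀ x → x ∈ bodyVars (trule λ₁) → ¬ Cyclic (tsub λ₁ x))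
        → Loaded (RPC R hc ρ) λ₁
        → UcUnblockable R hc λ₁
        → (trule λ₁ ≡ ρ → InjectiveOn (bodyVars (trule λ₁)) (tsub λ₁))
        → a ∈ outHC hc λ₁ → RPC R hc ρ a

clamp : ℕ → (m : ℕ) → Fin (suc m)
clamp zero    m       = Fin.zero
clamp (suc k) zero    = Fin.zero
clamp (suc k) (suc m) = Fin.suc (clamp k m)

-- hc_i (i ≥ 1, 1-based): disjunct min(i, branching ρ), here 0-based
hcᵢ : ℕ → HeadChoice
hcᵢ i ρ = clamp (i ∸ 1) (Data.List.length (L⁺.tail (heads ρ)))

branchingR : List Rule → ℕ
branchingR R = foldr _⊔_ 0 (map branching R)

RPCs : List Rule → Set
RPCs R = ∃[ i ] (1 ≤ i) × (i ≤ branchingR R) ×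
         ∃[ ρ ] ρ ∈ R × ∃[ t ] RhoCyclic ρ t × OccursIn t (RPC R (hcᵢ i) ρ)

{-# OPTIONS --safe #-}

-- Follow, in a finite chase tree, the branch selected by hc; its leaf F is a model.  Take the earliest
-- trigger (ρ, τ) in a derivation of RPC(R, hc, ρ) after the initial one; some frontier value τ x₀ is
-- functional.  If G maps the terms of RPC(R, hc, ρ) reversibly into the chase, then a uc-unblockable
-- trigger tr with G(tr) loaded for F has G(out(tr)) ⊆ F: otherwise inverting G on the skeleton of tr, and
-- collapsing all other terms, pulls F back into O(R, hc, tr, h^uc) and makes tr obsolete there.  Hence
-- G(RPC) ⊆ F as soon as the initial facts are mapped into F.  Since (ρ, τ) reproduces the initial facts,
-- this passes from G to the homomorphism c_x ↦ G(τ x), and iterating it yields images of c_{x₀} of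
-- unbounded size in F.
--
-- The database consists of D_ρ together with out(ρ, σ_uc), the functional terms of the latter being
-- replaced by constants, so that nothing has to be shown about the initial trigger being blocked.
module Submission where

open import Defs
open import Data.Nat using (ℕ; zero; suc; _+_; _≤_; _<_; z≤n; s≤s)
import Data.Nat as ℕ
open import Data.Nat.Properties using (≤-trans; ≤-<-trans; <-≤-trans; <-irrefl; m≤m+n; m≤n+m; n≤1+n)
open import Data.Fin using (Fin)
import Data.Fin as Fin
open import Data.List using (List; []; _∷_; map; concatMap; filter; length; _++_)
open import Data.Nat.ListAction using (sum)
open import Data.List.NonEmpty using (List⁺; _∷_; toList)
open import Data.List.Properties using (≡-dec; map-∘; map-cong-local; length-map; ∷-injective)
open import Data.List.Membership.Propositional using (_∈_; _∉_; find; lose)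
open import Data.List.Membership.Propositional.Properties
  using (∈-map⁺; ∈-map⁻; ∈-++⁺ˡ; ∈-++⁺ʳ; ∈-++⁻; ∈-concatMap⁺; ∈-concatMap⁻; ∈-filter⁺; ∈-filter⁻;
         ∈-deduplicate⁺; ∈-deduplicate⁻; ∈-lookup)
import Data.List.Membership.DecPropositional as DecMembership
open import Data.List.Relation.Unary.All as All using (All; []; _∷_)
open import Data.List.Relation.Unary.Any as Any using (Any; here; there)
open import Data.List.Relation.Unary.AllPairs using ([]; _∷_)
open import Data.List.Relation.Unary.Unique.Propositional using (Unique)
open import Data.List.Relation.Unary.Unique.DecPropositional.Properties using (deduplicate-!)
open import Data.List.Relation.Binary.Pointwise using (Pointwise; []; _∷_)
open import Data.Maybe using (Maybe; just; nothing)
import Data.Maybe.Properties as Maybe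
open import Data.Product using (Σ; ∃-syntax; _×_; _,_; proj₁; proj₂; uncurry)
import Data.Product.Properties as Product
open import Data.Sum using (_⊎_; inj₁; inj₂)
import Data.Sum.Properties as Sum
open import Data.Empty using (⊥)
open import Function using (_∘_; id; case_of_)
open import Relation.Nullary using (¬_; Dec; yes; no; contradiction)
open import Relation.Nullary.Decidable using (map′; _×-dec_; _⊎-dec_; ¬?; decidable-stable)
open import Relation.Unary using (Decidable)
open import Relation.Binary.Definitions using (DecidableEquality)
open import Relation.Binary.PropositionalEquality
  using (_≡_; _≢_; refl; sym; trans; cong; cong₂; subst)

-- Atoms, lists and sums.

private variable
  A B C : Set

mapAtom-cong : {f g : A → B} (a : Atom A) → (∀ {x} → x ∈ args a → f x ≡ g x) → mapAtom f a ≡ mapAtom g a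
mapAtom-cong (atom p ts) eq = cong (atom p) (map-cong-local (All.tabulate eq))

mapAtom-∘ : {g : B → C} {f : A → B} (a : Atom A) → mapAtom (g ∘ f) a ≡ mapAtom g (mapAtom f a)
mapAtom-∘ (atom p ts) = cong (atom p) (map-∘ ts)

mapAtom-args⁺ : (f : A → B) (a : Atom A) {x : A} → x ∈ args a → f x ∈ args (mapAtom f a)
mapAtom-args⁺ f (atom p ts) = ∈-map⁺ f

mapAtom-args⁻ : (f : A → B) (a : Atom A) {y : B} → y ∈ args (mapAtom f a) → ∃[ x ] x ∈ args a × y ≡ f x
mapAtom-args⁻ f (atom p ts) = ∈-map⁻ f

mapAtom-SamePred : (f : A → B) (a : Atom A) → SamePred a (mapAtom f a)
mapAtom-SamePred f (atom p ts) = refl , sym (length-map f ts)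

mapAtom-HFact : {h : GTerm → GTerm → Set} (f g : A → GTerm) (a : Atom A) →
  (∀ {x} → x ∈ args a → h (f x) (g x)) → HFact h (mapAtom f a) (mapAtom g a)
mapAtom-HFact {h = h} f g (atom p ts) rel = refl , go ts rel
  where
  go : ∀ xs → (∀ {x} → x ∈ xs → h (f x) (g x)) → Pointwise h (map f xs) (map g xs)
  go []       r = []
  go (x ∷ xs) r = r (here refl) ∷ go xs (r ∘ there)

∈-cm⁺ : (f : A → List B) {xs : List A} {x : A} {y : B} → x ∈ xs → y ∈ f x → y ∈ concatMap f xs
∈-cm⁺ f x∈ y∈ = ∈-concatMap⁺ f (lose x∈ y∈)

∈-cm⁻ : (f : A → List B) (xs : List A) {y : B} → y ∈ concatMap f xs → ∃[ x ] x ∈ xs × y ∈ f x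
∈-cm⁻ f xs y∈ = find (∈-concatMap⁻ f {xs} y∈)

∈⇒≤sum : ∀ {n ns} → n ∈ ns → n ≤ sum ns
∈⇒≤sum {n} {_ ∷ ns} (here refl) = m≤m+n n (sum ns)
∈⇒≤sum {n} {m ∷ ns} (there n∈)  = ≤-trans (∈⇒≤sum n∈) (m≤n+m (sum ns) m)

-- Decidable equality of rules, function symbols, terms and facts.

retract-≟ : (f : A → B) (g : B → A) → (∀ x → g (f x) ≡ x) → DecidableEquality B → DecidableEquality A
retract-≟ f g gf _≟_ x y =
  map′ (λ eq → trans (sym (gf x)) (trans (cong g eq) (gf y))) (cong f) (f x ≟ f y)

atom-≟ : DecidableEquality A → DecidableEquality (Atom A)
atom-≟ _≟_ = retract-≟ (λ a → pred a , args a) (uncurry atom) (λ _ → refl)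
  (Product.≡-dec ℕ._≟_ (≡-dec _≟_))

_≟ᴿ_ : DecidableEquality Rule
_≟ᴿ_ = retract-≟ {B = _ × _ × _}
  (λ ρ → body ρ , List⁺.head (heads ρ) , List⁺.tail (heads ρ))
  (λ (b , h , hs) → rule b (h ∷ hs)) (λ _ → refl)
  (Product.≡-dec atoms (Product.≡-dec atoms (≡-dec atoms)))
  where
  atoms : DecidableEquality (List (Atom Var))
  atoms = ≡-dec (atom-≟ ℕ._≟_)

_≟ᶠ_ : DecidableEquality FSym
_≟ᶠ_ = retract-≟ {B = Σ Rule (λ ρ → Fin (branching ρ) × Var)}
  (λ f → frule f , fidx f , fvar f) (λ (ρ , i , v) → fsym ρ i v) (λ _ → refl)
  (Product.≡-dec _≟ᴿ_ (Product.≡-dec Fin._≟_ ℕ._≟_))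

_≟ᶜ_ : DecidableEquality Const
_≟ᶜ_ = retract-≟ encode decode decode∘encode
  (Sum.≡-dec (Sum.≡-dec ℕ._≟_ ℕ._≟_) (Maybe.≡-dec _≟ᶠ_))
  where
  encode : Const → (ℕ ⊎ Var) ⊎ Maybe FSym
  encode (con n)  = inj₁ (inj₁ n)
  encode (cvar x) = inj₁ (inj₂ x)
  encode (cfun f) = inj₂ (just f)
  encode star     = inj₂ nothing
  decode : (ℕ ⊎ Var) ⊎ Maybe FSym → Const
  decode (inj₁ (inj₁ n))  = con n
  decode (inj₁ (inj₂ x))  = cvar x
  decode (inj₂ (just f))  = cfun f
  decode (inj₂ nothing)   = star
  decode∘encode : ∀ c → decode (encode c) ≡ c
  decode∘encode (con _)  = refl
  decode∘encode (cvar _) = refl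
  decode∘encode (cfun _) = refl
  decode∘encode star     = refl

-- Terms nest through lists, so the induction hypotheses are handed over as `All`. Equality of terms
-- and the search for nodes are decided by this induction.
module _ (P : GTerm → Set) (const-case : ∀ c → P (const c))
         (app-case : ∀ f ts → All P ts → P (app f ts)) where

  GTerm-ind  : ∀ t → P t
  GTerm-inds : ∀ ts → All P ts
  GTerm-ind (const c)  = const-case c
  GTerm-ind (app f ts) = app-case f ts (GTerm-inds ts)
  GTerm-inds []        = []
  GTerm-inds (t ∷ ts)  = GTerm-ind t ∷ GTerm-inds ts

const-inj : ∀ {c d} → GTerm.const c ≡ const d → c ≡ d
const-inj refl = refl

app-inj : ∀ {f g ss ts} → app f ss ≡ app g ts → f ≡ g × ss ≡ ts
app-inj refl = refl , refl

_≟ᵀ_ : DecidableEquality GTerm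
_≟ᵀ_ = GTerm-ind (λ t → ∀ u → Dec (t ≡ u)) const-≟ app-≟
  where
  const-≟ : ∀ c u → Dec (const c ≡ u)
  const-≟ c (const d) = map′ (cong const) const-inj (c ≟ᶜ d)
  const-≟ c (app _ _) = no λ ()
  list-≟ : ∀ {ts} → All (λ t → ∀ u → Dec (t ≡ u)) ts → ∀ us → Dec (ts ≡ us)
  list-≟ []       []       = yes refl
  list-≟ []       (_ ∷ _)  = no λ ()
  list-≟ (_ ∷ _)  []       = no λ ()
  list-≟ (d ∷ ds) (u ∷ us) = map′ (uncurry (cong₂ _∷_)) ∷-injective (d u ×-dec list-≟ ds us)
  app-≟ : ∀ f ts → All (λ t → ∀ u → Dec (t ≡ u)) ts → ∀ u → Dec (app f ts ≡ u)
  app-≟ f ts ds (const _)  = no λ ()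
  app-≟ f ts ds (app g us) = map′ (uncurry (cong₂ app)) app-inj ((f ≟ᶠ g) ×-dec list-≟ ds us)

_≟ᴬ_ : DecidableEquality Fact
_≟ᴬ_ = atom-≟ _≟ᵀ_

isConst? : Decidable IsConst
isConst? (const c)  = yes (c , refl)
isConst? (app _ _)  = no λ ()

app-not-const : ∀ {f ts} → ¬ IsConst (app f ts)
app-not-const (_ , ())

not-const-app : ∀ {t} → ¬ IsConst t → ∃[ f ] ∃[ ts ] t ≡ app f ts
not-const-app {const c}  ¬c = contradiction (c , refl) ¬c
not-const-app {app f ts} ¬c = f , ts , refl

open DecMembership ℕ._≟_ using () renaming (_∈?_ to _∈ⱽ?_)
open DecMembership _≟ᴬ_ using () renaming (_∈?_ to _∈ᶠ?_)
open DecMembership _≟ᵀ_ using () renaming (_∈?_ to _∈ᵀ?_)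

-- Variables of rules and skolemised heads

module _ (ρ : Rule) where

  bodyVar : ∀ {x b} → b ∈ body ρ → x ∈ args b → x ∈ bodyVars ρ
  bodyVar = ∈-cm⁺ args

  disjunctVar : ∀ i {x} → x ∈ atomsVars (disjunct ρ i) → x ∈ allHeadVars ρ
  disjunctVar i = ∈-cm⁺ atomsVars (∈-lookup {xs = toList (heads ρ)} i)

  headVar : ∀ i {x b} → b ∈ disjunct ρ i → x ∈ args b → x ∈ allHeadVars ρ
  headVar i b∈ x∈ = disjunctVar i (∈-cm⁺ args b∈ x∈)

  frontier⁺ : ∀ {x} → x ∈ bodyVars ρ → x ∈ allHeadVars ρ → x ∈ frontier ρ
  frontier⁺ x∈b x∈h = ∈-deduplicate⁺ ℕ._≟_ (∈-filter⁺ (_∈ⱽ? allHeadVars ρ) x∈b x∈h)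

  frontier⇒body : ∀ {x} → x ∈ frontier ρ → x ∈ bodyVars ρ
  frontier⇒body x∈ =
    proj₁ (∈-filter⁻ (_∈ⱽ? allHeadVars ρ) {xs = bodyVars ρ} (∈-deduplicate⁻ ℕ._≟_ _ x∈))

frontier-unique : ∀ ρ → Unique (frontier ρ)
frontier-unique ρ = deduplicate-! ℕ._≟_ _

skSubst-body : ∀ ρ i σ {v} → v ∈ bodyVars ρ → skSubst ρ i σ v ≡ σ v
skSubst-body ρ i σ {v} v∈ with v ∈ⱽ? bodyVars ρ
... | yes _  = refl
... | no v∉  = contradiction v∈ v∉

skSubst-exist : ∀ ρ i σ {v} → v ∉ bodyVars ρ → skSubst ρ i σ v ≡ app (fsym ρ i v) (map σ (frontier ρ))
skSubst-exist ρ i σ {v} v∉ with v ∈ⱽ? bodyVars ρ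
... | yes v∈ = contradiction v∈ v∉
... | no _   = refl

-- Skolem terms take only frontier terms as arguments, and a body variable that occurs in a head
-- belongs to the frontier.
skSubst-cong : ∀ ρ i {σ σ′ v} → (∀ {x} → x ∈ frontier ρ → σ x ≡ σ′ x) → v ∈ allHeadVars ρ →
  skSubst ρ i σ v ≡ skSubst ρ i σ′ v
skSubst-cong ρ i {σ} {σ′} {v} eq v∈h with v ∈ⱽ? bodyVars ρ
... | yes v∈ = eq (frontier⁺ ρ v∈ v∈h)
... | no _   = cong (app (fsym ρ i v)) (map-cong-local (All.tabulate eq))

out⁻ : ∀ ρ i σ {a} → a ∈ out (trig ρ σ) i → ∃[ b ] b ∈ disjunct ρ i × a ≡ mapAtom (skSubst ρ i σ) b
out⁻ ρ i σ = ∈-map⁻ (mapAtom (skSubst ρ i σ))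

out⁺ : ∀ ρ i σ {b} → b ∈ disjunct ρ i → mapAtom (skSubst ρ i σ) b ∈ out (trig ρ σ) i
out⁺ ρ i σ = ∈-map⁺ (mapAtom (skSubst ρ i σ))

out-cong : ∀ ρ i {σ σ′ a} → (∀ {x} → x ∈ frontier ρ → σ x ≡ σ′ x) →
  a ∈ out (trig ρ σ) i → a ∈ out (trig ρ σ′) i
out-cong ρ i {σ} {σ′} eq a∈ with out⁻ ρ i σ a∈
... | b , b∈ , refl = subst (_∈ out (trig ρ σ′) i)
  (mapAtom-cong b (λ v∈ → sym (skSubst-cong ρ i eq (headVar ρ i b∈ v∈)))) (out⁺ ρ i σ′ b∈)

data OutTerm (ρ : Rule) (i : Fin (branching ρ)) (σ : Subst) : GTerm → Set where
  frontierTerm : ∀ {x} → x ∈ frontier ρ → OutTerm ρ i σ (σ x)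
  skolemTerm   : ∀ {v} → v ∈ atomsVars (disjunct ρ i) → v ∉ bodyVars ρ →
    OutTerm ρ i σ (app (fsym ρ i v) (map σ (frontier ρ)))

outTerm : ∀ ρ i σ {v} → v ∈ atomsVars (disjunct ρ i) → OutTerm ρ i σ (skSubst ρ i σ v)
outTerm ρ i σ {v} v∈ with v ∈ⱽ? bodyVars ρ
... | yes v∈b = frontierTerm (frontier⁺ ρ v∈b (disjunctVar ρ i v∈))
... | no v∉b  = skolemTerm v∈ v∉b

out-args : ∀ ρ i σ {a t} → a ∈ out (trig ρ σ) i → t ∈ args a → OutTerm ρ i σ t
out-args ρ i σ a∈ t∈ with out⁻ ρ i σ a∈
... | b , b∈ , refl with mapAtom-args⁻ _ b t∈
... | v , v∈ , refl = outTerm ρ i σ (∈-cm⁺ args b∈ v∈)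

loaded-arg : ∀ {F : FactSet} {P : GTerm → Set} (tr : Trigger) → (∀ {a t} → F a → t ∈ args a → P t) →
  Loaded F tr → ∀ {x} → x ∈ bodyVars (trule tr) → P (tsub tr x)
loaded-arg (trig ρ σ) good ld x∈ with ∈-cm⁻ args (body ρ) x∈
... | b , b∈ , x∈b = good (ld b b∈) (mapAtom-args⁺ σ b x∈b)

-- Substitutions read off from argument lists.

assign-map : ∀ xs (σ : Subst) {x} → x ∈ xs → assign xs (map σ xs) x ≡ σ x
assign-map (y ∷ xs) σ {x} x∈ with x ℕ.≟ y
... | yes refl = refl
assign-map (y ∷ xs) σ (here refl) | no x≢y = contradiction refl x≢y
assign-map (y ∷ xs) σ (there x∈)  | no _   = assign-map xs σ x∈

assign-range : ∀ xs ss y → assign xs ss y ∈ ss ⊎ assign xs ss y ≡ const star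
assign-range []       ss       y = inj₂ refl
assign-range (x ∷ xs) []       y = inj₂ refl
assign-range (x ∷ xs) (s ∷ ss) y with y ℕ.≟ x
... | yes _ = inj₁ (here refl)
... | no _  with assign-range xs ss y
...   | inj₁ s∈ = inj₁ (there s∈)
...   | inj₂ eq = inj₂ eq

assign-∈ : ∀ xs ss {x} → length ss ≡ length xs → x ∈ xs → assign xs ss x ∈ ss
assign-∈ (y ∷ xs) (s ∷ ss) {x} len x∈ with x ℕ.≟ y
... | yes refl = here refl
assign-∈ (y ∷ xs) (s ∷ ss) len (here refl) | no x≢y = contradiction refl x≢y
assign-∈ (y ∷ xs) (s ∷ ss) len (there x∈)  | no _   = there (assign-∈ xs ss (cong ℕ.pred len) x∈)

map-assign : ∀ {xs ss} → Unique xs → length ss ≡ length xs → map (assign xs ss) xs ≡ ss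
map-assign {[]}     {[]}     _ _ = refl
map-assign {x ∷ xs} {s ∷ ss} (x∉ ∷ uq) len = cong₂ _∷_ hd
  (trans (map-cong-local (All.map tl x∉)) (map-assign uq (cong ℕ.pred len)))
  where
  hd : assign (x ∷ xs) (s ∷ ss) x ≡ s
  hd with x ℕ.≟ x
  ... | yes _  = refl
  ... | no x≢x = contradiction refl x≢x
  tl : ∀ {y} → x ≢ y → assign (x ∷ xs) (s ∷ ss) y ≡ assign xs ss y
  tl {y} x≢y with y ℕ.≟ x
  ... | yes y≡x = contradiction (sym y≡x) x≢y
  ... | no _    = refl

assign-image : ∀ xs ss (G : GTerm → GTerm) (σ : Subst) {x} →
  map G ss ≡ map σ xs → x ∈ xs → G (assign xs ss x) ≡ σ x
assign-image (y ∷ xs) (s ∷ ss) G σ {x} eq x∈ with x ℕ.≟ y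
... | yes refl = proj₁ (∷-injective eq)
assign-image (y ∷ xs) (s ∷ ss) G σ eq (here refl) | no x≢y = contradiction refl x≢y
assign-image (y ∷ xs) (s ∷ ss) G σ eq (there x∈)  | no _   =
  assign-image xs ss G σ (proj₂ (∷-injective eq)) x∈

-- Birth facts and skeletons

-- The relation `Birth` as a finite list. It makes the skeleton of a trigger finite, so that
-- preimages in it can be searched for constructively.
births  : List GTerm → List Fact
birth   : GTerm → List Fact
birth (const c)   = []
birth (app f ss)  = out (fTrigger f ss) (fidx f) ++ births ss
births []         = []
births (s ∷ ss)   = birth s ++ births ss

births⁺ : ∀ {s ss a} → s ∈ ss → a ∈ birth s → a ∈ births ss
births⁺ {ss = s ∷ ss} (here refl) a∈ = ∈-++⁺ˡ a∈
births⁺ {ss = s ∷ ss} (there s∈)  a∈ = ∈-++⁺ʳ (birth s) (births⁺ s∈ a∈)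

birth⁺ : ∀ {t a} → Birth t a → a ∈ birth t
birth⁺ (own a∈)                          = ∈-++⁺ˡ a∈
birth⁺ {app f ss} (sub s∈ b)             = ∈-++⁺ʳ (out (fTrigger f ss) (fidx f)) (births⁺ s∈ (birth⁺ b))

birth⁻  : ∀ t {a} → a ∈ birth t → Birth t a
births⁻ : ∀ ss {a} → a ∈ births ss → ∃[ s ] s ∈ ss × Birth s a
birth⁻ (app f ss) a∈ with ∈-++⁻ (out (fTrigger f ss) (fidx f)) a∈
... | inj₁ a∈out = own a∈out
... | inj₂ a∈ss  with births⁻ ss a∈ss
...   | s , s∈ , b = sub s∈ b
births⁻ (s ∷ ss) a∈ with ∈-++⁻ (birth s) a∈
... | inj₁ a∈s  = s , here refl , birth⁻ s a∈s
... | inj₂ a∈ss with births⁻ ss a∈ss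
...   | s′ , s′∈ , b = s′ , there s′∈ , b

-- An argument of an own fact is either a frontier value or a skolem term with the same rule,
-- disjunct and arguments. The former is in `ss`, or is the default `const star`, which has no birth
-- facts; the latter has the same own facts.
birth-closed : ∀ {t a s b} → Birth t a → s ∈ args a → Birth s b → Birth t b
birth-closed (sub s′∈ b₁) s∈ b₂ = sub s′∈ (birth-closed b₁ s∈ b₂)
birth-closed {b = b} (own {f} {ss} a∈) s∈ b₂ = case-out (out-args (frule f) (fidx f) σ a∈ s∈) b₂
  where
  σ : Subst
  σ = assign (frontier (frule f)) ss
  arg : ∀ x → Birth (σ x) b → Birth (app f ss) b
  arg x b₂ with σ x | assign-range (frontier (frule f)) ss x
  arg x b₂ | _ | inj₁ s∈   = sub s∈ b₂
  arg x () | _ | inj₂ refl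
  case-out : ∀ {s} → OutTerm (frule f) (fidx f) σ s → Birth s b → Birth (app f ss) b
  case-out (frontierTerm {x} _) b₂       = arg x b₂
  case-out (skolemTerm _ _)     (own b∈) =
    own (out-cong (frule f) (fidx f) (assign-map (frontier (frule f)) σ) b∈)
  case-out (skolemTerm _ _)     (sub t∈ b₃) with ∈-map⁻ σ t∈
  ... | x , _ , refl = arg x b₃

skelList : Trigger → List GTerm
skelList (trig ψ τ) =
  concatMap args (concatMap (birth ∘ τ) (frontier ψ)) ++ filter isConst? (map τ (frontier ψ))

skelList⁺ : ∀ tr {t} → Skel tr t → t ∈ skelList tr
skelList⁺ (trig ψ τ) (inj₁ (a , (x , x∈ , b) , t∈)) =
  ∈-++⁺ˡ (∈-cm⁺ args (∈-cm⁺ (birth ∘ τ) x∈ (birth⁺ b)) t∈)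
skelList⁺ (trig ψ τ) (inj₂ (x , x∈ , refl , c)) =
  ∈-++⁺ʳ (concatMap args (concatMap (birth ∘ τ) (frontier ψ))) (∈-filter⁺ isConst? (∈-map⁺ τ x∈) c)

skelList⁻ : ∀ tr {t} → t ∈ skelList tr → Skel tr t
skelList⁻ (trig ψ τ) t∈ with ∈-++⁻ (concatMap args (concatMap (birth ∘ τ) (frontier ψ))) t∈
... | inj₁ t∈b with ∈-cm⁻ args (concatMap (birth ∘ τ) (frontier ψ)) t∈b
...   | a , a∈ , t∈a with ∈-cm⁻ (birth ∘ τ) (frontier ψ) a∈
...     | x , x∈ , a∈x = inj₁ (a , (x , x∈ , birth⁻ (τ x) a∈x) , t∈a)
skelList⁻ (trig ψ τ) t∈ | inj₂ t∈c with ∈-filter⁻ isConst? {xs = map τ (frontier ψ)} t∈c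
... | t∈τ , c with ∈-map⁻ τ t∈τ
...   | x , x∈ , refl = inj₂ (x , x∈ , refl , c)

-- One functional term of the skeleton thus brings in the whole output of the trigger that created
-- it.
skel-birth : ∀ tr {f ss a} → Skel tr (app f ss) → Birth (app f ss) a → BirthT tr a
skel-birth _ (inj₁ (_ , (x , x∈ , b₁) , t∈)) b₂ = x , x∈ , birth-closed b₁ t∈ b₂
skel-birth _ (inj₂ (_ , _ , _ , c))          b₂ = contradiction c app-not-const

own-skolem : ∀ {f ss v b} →
  b ∈ disjunct (frule f) (fidx f) → v ∈ args b → v ∉ bodyVars (frule f) →
  length ss ≡ length (frontier (frule f)) →
  ∃[ a ] Birth (app f ss) a × app (fsym (frule f) (fidx f) v) ss ∈ args a
own-skolem {f} {ss} {v} {b} b∈ v∈ v∉ len =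
  _ , own (out⁺ (frule f) (fidx f) σ b∈) , 
  subst (_∈ args (mapAtom (skSubst (frule f) (fidx f) σ) b)) eq (mapAtom-args⁺ (skSubst (frule f) (fidx f) σ) b v∈)
  where
  σ : Subst
  σ = assign (frontier (frule f)) ss
  eq : skSubst (frule f) (fidx f) σ v ≡ app (fsym (frule f) (fidx f) v) ss
  eq = trans (skSubst-exist (frule f) (fidx f) σ v∉)
    (cong (app _) (map-assign (frontier-unique (frule f)) len))

-- Constants are put into the skeleton explicitly. A functional term over the skolemised rules
-- occurs in its own birth facts, because its variable occurs in the disjunct and its argument list
-- has the right length.
skel-frontier : ∀ {R} tr {x} → x ∈ frontier (trule tr) → OverSk R (tsub tr x) → Skel tr (tsub tr x)
skel-frontier (trig ψ τ) {x} x∈ o with τ x in eq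
... | const c = inj₂ (x , x∈ , eq , c , refl)
skel-frontier (trig ψ τ) {x} x∈ (oapp {f} _ v∈ v∉ len _) | app f ts
  with ∈-cm⁻ args (disjunct (frule f) (fidx f)) v∈
... | b , b∈ , v∈b with own-skolem {f} b∈ v∈b v∉ len
...   | a , bt , t∈ = inj₁ (a , (x , x∈ , subst (λ t → Birth t a) (sym eq) bt) , t∈)

-- Only the rule of the skolem function is recorded, so that all terms created by one trigger are alike.

data Node (χ : Rule) (ss : List GTerm) : GTerm → Set where
  nhere : ∀ {f} → frule f ≡ χ → Node χ ss (app f ss)
  ndeep : ∀ {f ts t} → t ∈ ts → Node χ ss t → Node χ ss (app f ts)

node-arg : ∀ {χ ψ ss us t w} → Node χ us w → t ∈ us → Node ψ ss t → Node ψ ss w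
node-arg (nhere _)    t∈ m = ndeep t∈ m
node-arg (ndeep w∈ n) t∈ m = ndeep w∈ (node-arg n t∈ m)

node? : ∀ χ ss → Decidable (Node χ ss)
node? χ ss = GTerm-ind (λ t → Dec (Node χ ss t)) (λ _ → no λ ()) step
  where
  any : ∀ {ts} → All (λ t → Dec (Node χ ss t)) ts → Dec (Any (Node χ ss) ts)
  any []       = no λ ()
  any (d ∷ ds) = map′ Any.fromSum Any.toSum (d ⊎-dec any ds)
  step : ∀ f ts → All (λ t → Dec (Node χ ss t)) ts → Dec (Node χ ss (app f ts))
  step f ts ds with (frule f ≟ᴿ χ) ×-dec (≡-dec _≟ᵀ_ ts ss) | any ds
  ... | yes (eq , refl) | _     = yes (nhere eq)
  ... | no _            | yes p = let t , t∈ , n = find p in yes (ndeep t∈ n)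
  ... | no ¬h           | no ¬p = no λ where
    (nhere eq)   → ¬h (eq , refl)
    (ndeep t∈ n) → ¬p (lose t∈ n)

size : GTerm → ℕ
sizes : List GTerm → ℕ
size (const _)   = 0
size (app _ ts)  = suc (sizes ts)
sizes []         = 0
sizes (t ∷ ts)   = size t + sizes ts

size-arg : ∀ {t ts} → t ∈ ts → size t ≤ sizes ts
size-arg {ts = t ∷ ts} (here refl) = m≤m+n (size t) (sizes ts)
size-arg {ts = t ∷ ts} (there t∈)  = ≤-trans (size-arg t∈) (m≤n+m (sizes ts) (size t))

node-size : ∀ {χ ss t u} → u ∈ ss → Node χ ss t → size u < size t
node-size u∈ (nhere _)    = s≤s (size-arg u∈)
node-size u∈ (ndeep t∈ n) = <-≤-trans (node-size u∈ n) (≤-trans (size-arg t∈) (n≤1+n _))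

-- By uc-unblockability, every functional term of RPC(R, hc, ρ) grows out of out(ρ, σ_uc).

module _ (ρ : Rule) where

  uc-frontier : List GTerm
  uc-frontier = map σuc (frontier ρ)

  data Rooted : GTerm → Set where
    rvar : ∀ {x} → x ∈ bodyVars ρ → Rooted (const (cvar x))
    rapp : ∀ {f ts} → (∀ {t} → t ∈ ts → Rooted t) → Node ρ uc-frontier (app f ts) → Rooted (app f ts)

  rooted-arg : ∀ {f ts t} → Rooted (app f ts) → t ∈ ts → Rooted t
  rooted-arg (rapp g _) t∈ = g t∈

  rooted-node : ∀ {f ts} → Rooted (app f ts) → Node ρ uc-frontier (app f ts)
  rooted-node (rapp _ n) = n

  rooted-sibling : ∀ {f g ts} → frule f ≡ frule g → Rooted (app f ts) → Rooted (app g ts)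
  rooted-sibling eq (rapp g (nhere eq′))    = rapp g (nhere (trans (sym eq) eq′))
  rooted-sibling eq (rapp g (ndeep t∈ n))   = rapp g (ndeep t∈ n)

  record Proper (R : List Rule) (t : GTerm) : Set where
    constructor proper
    field
      rooted : Rooted t
      overSk : OverSk R t
  open Proper public

  birth-proper : ∀ {R t a s} → Proper R t → Birth t a → s ∈ args a → Proper R s
  birth-proper (proper g (oapp _ _ _ _ os)) (sub s∈ b) t∈ =
    birth-proper (proper (rooted-arg g s∈) (os _ s∈)) b t∈
  birth-proper (proper g (oapp {f} {ss} f∈ _ _ len os)) (own a∈) t∈ with out-args (frule f) (fidx f) _ a∈ t∈
  ... | frontierTerm x∈ = let s∈ = assign-∈ (frontier (frule f)) ss len x∈ in proper (rooted-arg g s∈) (os _ s∈)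
  ... | skolemTerm v∈ v∉ =
    subst (Proper _) (cong (app _) (sym (map-assign (frontier-unique (frule f)) len)))
      (proper (rooted-sibling refl g) (oapp f∈ v∈ v∉ len os))

  skel-proper : ∀ {R} tr {t} → (∀ {x} → x ∈ bodyVars (trule tr) → Proper R (tsub tr x)) → Skel tr t → Proper R t
  skel-proper (trig ψ τ) p (inj₁ (a , (x , x∈ , b) , t∈)) = birth-proper (p (frontier⇒body ψ x∈)) b t∈
  skel-proper (trig ψ τ) p (inj₂ (x , x∈ , refl , _))     = p (frontier⇒body ψ x∈)

-- Chase branches following a head-choice

data Branch (R : List Rule) (hc : HeadChoice) (D : List Fact) : List Fact → Set where
  root : Branch R hc D D
  step : ∀ {F} tr → Branch R hc D F → RTrigger R tr → Loaded (listSet F) tr → ¬ Obsolete (listSet F) tr →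
    Branch R hc D (F ++ outHC hc tr)

branch-⊇ : ∀ {R hc D F} → Branch R hc D F → ∀ {a} → a ∈ D → a ∈ F
branch-⊇ root              a∈ = a∈
branch-⊇ (step _ br _ _ _) a∈ = ∈-++⁺ˡ (branch-⊇ br a∈)

Model : List Rule → List Fact → Set
Model R F = ∀ tr → trule tr ∈ R → Loaded (listSet F) tr → Obsolete (listSet F) tr

finite-tree⇒model : ∀ {R hc D F} → FiniteChaseTree R F → Branch R hc D F → ∃[ F′ ] Branch R hc D F′ × Model R F′
finite-tree⇒model (leaf sat) br = _ , br , sat
finite-tree⇒model {hc = hc} (node tr rt ld ¬obs _ children) br =
  finite-tree⇒model (children (hc (trule tr))) (step tr br rt ld ¬obs)

single : ∀ {n} → n ≡ 1 → (i j : Fin n) → i ≡ j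
single refl Fin.zero Fin.zero = refl

-- With a single disjunct and no existential variables, obsolescence leaves no choice of disjunct or
-- of witnesses.
datalog-closed : ∀ {R F ψ σ} → Model R F → ψ ∈ R → Datalog ψ → Loaded (listSet F) (trig ψ σ) →
  ∀ i {b} → b ∈ disjunct ψ i → mapAtom σ b ∈ F
datalog-closed {ψ = ψ} sat ψ∈ (one , dl) ld i {b} b∈ with sat (trig ψ _) ψ∈ ld
... | j , σ′ , agree , hd with single one i j
... | refl = subst (_∈ _) (mapAtom-cong b (λ x∈ → agree _ (dl _ (headVar ψ i b∈ x∈)))) (hd b b∈)

-- Pulling a chase branch back into `O`.

body-pred : ∀ {R ψ b} (f : Var → GTerm) → ψ ∈ R → b ∈ body ψ → PredOf R (mapAtom f b)
body-pred {b = b} f ψ∈ b∈ = _ , ψ∈ , b , inj₁ b∈ , mapAtom-SamePred f b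

head-pred : ∀ {R ψ b} (f : Var → GTerm) → ψ ∈ R → ∀ i → b ∈ disjunct ψ i → PredOf R (mapAtom f b)
head-pred {ψ = ψ} {b} f ψ∈ i b∈ =
  ψ , ψ∈ , b , inj₂ (∈-cm⁺ id (∈-lookup {xs = toList (heads ψ)} i) b∈) , mapAtom-SamePred f b

-- The constants over which `O` contains all facts from the start.
Critical : Trigger → GTerm → Set
Critical tr t = ∃[ c ] t ≡ const c × (Skel tr (const c) ⊎ c ≡ star)

oall-critical : ∀ {R hc tr h b} {f : Var → GTerm} → PredOf R (mapAtom f b) →
  (∀ {x} → x ∈ args b → Critical tr (f x)) → O R hc tr h (mapAtom f b)
oall-critical {tr = tr} {b = b} {f} p crit = oall p λ t t∈ →
  let x , x∈ , eq = mapAtom-args⁻ f b t∈ in subst (Critical tr) (sym eq) (crit x∈)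

-- G embeds the terms of RPC(R, hc, ρ) into those of a chase from D; S contains the terms that occur,
-- or are created together with terms that occur, in the images of constants.

record Reversible (R : List Rule) (hc : HeadChoice) (ρ : Rule) (D : List Fact)
                  (G : GTerm → GTerm) (S : GTerm → Set) : Set where
  field
    S?        : Decidable S
    S-sibling : ∀ {f g us} → frule f ≡ frule g → S (app f us) → S (app g us)
    S-arg     : ∀ {f us u} → S (app f us) → u ∈ us → S u
    S-const   : ∀ {s} → Rooted ρ s → S (G s) → IsConst s
    G-inj     : ∀ {s t} → Rooted ρ s → Rooted ρ t → G s ≡ G t → s ≡ t
    -- A functional term in the range of `G` either has a preimage with the same symbol or already
    -- occurs inside the image of a constant.
    G-unapp   : ∀ {s f us} → Rooted ρ s → G s ≡ app f us →
      (∃[ ss ] s ≡ app f ss × map G ss ≡ us) ⊎ S (app f us)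
    -- Only triggers that the chase can apply are considered: the map `π` below does not commute
    -- with the symbols of the initial trigger, but that trigger is obsolete over the database.
    G-app     : ∀ {F χ υ ss v} → (∀ {a} → a ∈ D → a ∈ F) → ¬ Obsolete (listSet F) (trig χ υ) →
      map G ss ≡ map υ (frontier χ) →
      G (app (fsym χ (hc χ) v) ss) ≡ app (fsym χ (hc χ) v) (map υ (frontier χ))

-- H inverts G on the skeleton of tr and collapses all other terms as h^uc does, except that S goes to ⋆:
-- the facts over S need not be derivable in O, but O contains all facts over critical constants.

module Pullback {R hc ρ D G S} (rev : Reversible R hc ρ D G S) (tr : Trigger)
  (tr-proper : ∀ {x} → x ∈ bodyVars (trule tr) → Proper ρ R (tsub tr x))
  (out-rooted : ∀ {a t} → a ∈ outHC hc tr → t ∈ args a → Rooted ρ t) where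

  open Reversible rev

  skel⇒proper : ∀ {s} → Skel tr s → Proper ρ R s
  skel⇒proper = skel-proper ρ tr tr-proper

  skel⇒rooted : ∀ {s} → Skel tr s → Rooted ρ s
  skel⇒rooted sk = rooted (skel⇒proper sk)

  Image : GTerm → Set
  Image u = Any (λ s → G s ≡ u) (skelList tr)

  image? : Decidable Image
  image? u = Any.any? (λ s → G s ≟ᵀ u) (skelList tr)

  image⁺ : ∀ {s u} → Skel tr s → G s ≡ u → Image u
  image⁺ sk eq = lose (skelList⁺ tr sk) eq

  data Collapse (u : GTerm) : GTerm → Set where
    preimage : ∀ {s} → Skel tr s → G s ≡ u → Collapse u s
    shared   : ¬ Image u → IsConst u ⊎ S u → Collapse u (const star)
    fresh    : ∀ {f ts} → u ≡ app f ts → ¬ Image u → ¬ S u → Collapse u (const (cfun f))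

  collapse : ∀ u → ∃[ v ] Collapse u v
  collapse u with image? u
  ... | yes p = let s , s∈ , eq = find p in s , preimage (skelList⁻ tr s∈) eq
  ... | no ¬p with u | S? u
  ...   | const c  | _     = const star , shared ¬p (inj₁ (c , refl))
  ...   | app f ts | yes p = const star , shared ¬p (inj₂ p)
  ...   | app f ts | no ¬s = const (cfun f) , fresh refl ¬p ¬s

  H : GTerm → GTerm
  H u = proj₁ (collapse u)

  H-G : ∀ {s} → Skel tr s → H (G s) ≡ s
  H-G {s} sk with collapse (G s)
  ... | _ , preimage sk′ eq = G-inj (skel⇒rooted sk′) (skel⇒rooted sk) eq
  ... | _ , shared ¬p _     = contradiction (image⁺ sk refl) ¬p
  ... | _ , fresh _ ¬p _    = contradiction (image⁺ sk refl) ¬p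

  -- A rooted value of `H` cannot be one of the collapsing constants, so it comes from the skeleton.
  G-H : ∀ u → Rooted ρ (H u) → G (H u) ≡ u
  G-H u r with collapse u
  ... | _ , preimage _ eq = eq
  G-H u () | _ , shared _ _
  G-H u () | _ , fresh _ _ _

  H-overSk : ∀ u → OverSk R (H u)
  H-overSk u with collapse u
  ... | _ , preimage sk _ = overSk (skel⇒proper sk)
  ... | _ , shared _ _    = oconst
  ... | _ , fresh _ _ _   = oconst

  -- All values of `H` are skeleton terms, the special constant or some `cfun f`, and h^uc fixes
  -- each of these. The last two are not in the skeleton because they are not rooted.
  Huc-H : ∀ u → Huc tr (H u) (H u)
  Huc-H u with collapse u
  ... | _ , preimage sk _ = hskel sk
  ... | _ , shared _ _    = hstar (λ sk → case skel⇒rooted sk of λ ()) λ _ ()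
  ... | _ , fresh _ _ _   = hcf (λ sk → case skel⇒rooted sk of λ ())

  H-shared : ∀ {u} → S u → Critical tr (H u)
  H-shared {u} su with collapse u
  ... | _ , shared _ _   = star , refl , inj₂ refl
  ... | _ , fresh _ _ ¬s = contradiction su ¬s
  ... | _ , preimage sk refl with S-const (skel⇒rooted sk) su
  ...   | c , refl = c , refl , inj₁ sk

  Uc : FactSet
  Uc = O R hc tr (Huc tr)

  -- One chase step is pulled back in three ways. If a created term has a functional preimage in the
  -- skeleton, the output consists of images of birth facts; if one lies in `S`, the output
  -- collapses to critical constants; otherwise `O` applies the trigger `trig χ (H ∘ υ)` itself.
  module Step {F χ υ} (rt : RTrigger R (trig χ υ)) (D⊆F : ∀ {a} → a ∈ D → a ∈ F)
    (¬obs : ¬ Obsolete (listSet F) (trig χ υ)) (ld : Loaded Uc (trig χ (H ∘ υ)))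
    (avoids : ¬ (∀ a → a ∈ outHC hc tr → mapAtom G a ∈ outHC hc (trig χ υ))) where

    i : Fin (branching χ)
    i = hc χ

    sk sk-H : Subst
    sk   = skSubst χ i υ
    sk-H = skSubst χ i (H ∘ υ)

    new : Var → GTerm
    new v = app (fsym χ i v) (map υ (frontier χ))

    from-birth : ∀ {v ss b} → Skel tr (app (fsym χ i v) ss) → map G ss ≡ map υ (frontier χ) →
      b ∈ disjunct χ i → Uc (mapAtom (H ∘ sk) b)
    from-birth {v} {ss} {b} sk-v eqs b∈ = subst Uc (sym (mapAtom-cong b H-sk)) (obirth bt)
      where
      τ : Subst
      τ = assign (frontier χ) ss
      len : length ss ≡ length (frontier χ)
      len = trans (sym (length-map G ss)) (trans (cong length eqs) (length-map υ (frontier χ)))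
      bt : BirthT tr (mapAtom (skSubst χ i τ) b)
      bt = skel-birth tr sk-v (own (out⁺ χ i τ b∈))
      G-sk : ∀ {x} → x ∈ args b → G (skSubst χ i τ x) ≡ sk x
      G-sk {x} x∈ with x ∈ⱽ? bodyVars χ
      ... | yes x∈b = assign-image (frontier χ) ss G υ eqs (frontier⁺ χ x∈b (headVar χ i b∈ x∈))
      ... | no x∉b  = trans (cong (λ us → G (app (fsym χ i x) us)) (map-assign (frontier-unique χ) len))
        (G-app D⊆F ¬obs eqs)
      H-sk : ∀ {x} → x ∈ args b → H (sk x) ≡ skSubst χ i τ x
      H-sk x∈ = trans (cong H (sym (G-sk x∈)))
        (H-G (inj₁ (_ , bt , mapAtom-args⁺ (skSubst χ i τ) b x∈)))

    -- Every term of the output is an argument or a sibling of the shared skolem term, so `S`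
    -- contains them all.
    from-shared : ∀ {v b} → S (new v) → b ∈ disjunct χ i → Uc (mapAtom (H ∘ sk) b)
    from-shared {v} {b} sv b∈ = oall-critical (head-pred _ (proj₁ rt) i b∈)
      λ x∈ → H-shared (shared-out (outTerm χ i υ (∈-cm⁺ args b∈ x∈)))
      where
      shared-out : ∀ {t} → OutTerm χ i υ t → S t
      shared-out (frontierTerm x∈) = S-arg sv (∈-map⁺ υ x∈)
      shared-out (skolemTerm _ _)  = S-sibling refl sv

    lift : ∀ {x} → x ∈ allHeadVars χ → Rooted ρ (sk-H x) → G (sk-H x) ≡ sk x
    lift {x} x∈ r with x ∈ⱽ? bodyVars χ
    ... | yes x∈b = G-H (υ x) r
    ... | no _    = G-app D⊆F ¬obs (trans (sym (map-∘ (frontier χ)))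
      (map-cong-local (All.tabulate λ y∈ → G-H (υ _) (rooted-arg ρ r (∈-map⁺ (H ∘ υ) y∈)))))

    -- The terms of the output of `tr` are rooted. Were the two outputs equal, `lift` would place
    -- the `G`-image of that output in the output of the chase step, which `avoids` excludes.
    distinct : ¬ (outHC hc (trig χ (H ∘ υ)) ≐ outHC hc tr)
    distinct eq = avoids λ a a∈ → lifted a∈ (out⁻ χ i (H ∘ υ) (proj₂ (eq a) a∈))
      where
      lifted : ∀ {a} → a ∈ outHC hc tr → ∃[ b ] b ∈ disjunct χ i × a ≡ mapAtom sk-H b →
        mapAtom G a ∈ outHC hc (trig χ υ)
      lifted a∈ (b , b∈ , refl) = subst (_∈ outHC hc (trig χ υ))
        (trans (sym (mapAtom-cong b λ x∈ →
            lift (headVar χ i b∈ x∈) (out-rooted a∈ (mapAtom-args⁺ sk-H b x∈))))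
          (mapAtom-∘ b))
        (out⁺ χ i υ b∈)

    NotFresh : Var → Set
    NotFresh v = v ∉ bodyVars χ × (Image (new v) ⊎ S (new v))

    from-trigger : ∀ {b} → ¬ Any NotFresh (atomsVars (disjunct χ i)) → b ∈ disjunct χ i → Uc (mapAtom (H ∘ sk) b)
    from-trigger {b} ¬nf b∈ = oout (trig χ (H ∘ υ)) (proj₁ rt , λ x _ → H-overSk (υ x)) ld distinct
      (out⁺ χ i (H ∘ υ) b∈) (mapAtom-HFact sk-H (H ∘ sk) b related)
      where
      related : ∀ {x} → x ∈ args b → Huc tr (sk-H x) (H (sk x))
      related {x} x∈ with x ∈ⱽ? bodyVars χ | lift {x} (headVar χ i b∈ x∈)
      ... | yes _ | _      = Huc-H (υ x)
      ... | no x∉ | lifted with collapse (new x)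
      ...   | _ , preimage s eq      = contradiction (lose (∈-cm⁺ args b∈ x∈) (x∉ , inj₁ (image⁺ s eq))) ¬nf
      ...   | _ , shared _ (inj₁ c)  = contradiction c app-not-const
      ...   | _ , shared _ (inj₂ sv) = contradiction (lose (∈-cm⁺ args b∈ x∈) (x∉ , inj₂ sv)) ¬nf
      -- If the skolem term over `H ∘ υ` were in the skeleton, it would be rooted, and `lift` would
      -- make it a preimage of `new x`.
      ...   | _ , fresh refl ¬im _   = hfun λ s → ¬im (image⁺ s (lifted (skel⇒rooted s)))

    step-into-Uc : ∀ {a} → a ∈ outHC hc (trig χ υ) → Uc (mapAtom H a)
    step-into-Uc a∈ with out⁻ χ i υ a∈
    ... | b , b∈ , refl = subst Uc (mapAtom-∘ b) (by-cases (Any.any? not-fresh? (atomsVars (disjunct χ i))))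
      where
      not-fresh? : Decidable NotFresh
      not-fresh? v = ¬? (v ∈ⱽ? bodyVars χ) ×-dec (image? (new v) ⊎-dec S? (new v))
      by-image : ∀ {v} → Image (new v) → Uc (mapAtom (H ∘ sk) b)
      by-image p with find p
      ... | s , s∈ , eq with G-unapp (skel⇒rooted (skelList⁻ tr s∈)) eq
      ...   | inj₁ (_ , refl , eqs) = from-birth (skelList⁻ tr s∈) eqs b∈
      ...   | inj₂ sv               = from-shared sv b∈
      by-cases : Dec (Any NotFresh (atomsVars (disjunct χ i))) → Uc (mapAtom (H ∘ sk) b)
      by-cases (no ¬nf) = from-trigger ¬nf b∈
      by-cases (yes p) with find p
      ... | v , _ , _ , inj₁ im = by-image im
      ... | v , _ , _ , inj₂ sv = from-shared sv b∈

  Produces : List Fact → Set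
  Produces F = ∀ a → a ∈ outHC hc tr → mapAtom G a ∈ F

  module _ (base : ∀ {a} → a ∈ D → Uc (mapAtom H a)) where

    -- As long as `F` lacks part of the image of the output of `tr`, no step of the branch has
    -- produced that image, so `Step` applies to each of them.
    branch-into-Uc : ∀ {F} → Branch R hc D F → ¬ Produces F → ∀ {a} → a ∈ F → Uc (mapAtom H a)
    branch-into-Uc root _ a∈ = base a∈
    branch-into-Uc (step {F} (trig χ υ) br rt ld ¬obs) ¬prod a∈ with ∈-++⁻ F a∈
    ... | inj₁ a∈F   = branch-into-Uc br (λ p → ¬prod λ a a∈ → ∈-++⁺ˡ (p a a∈)) a∈F
    ... | inj₂ a∈out = Step.step-into-Uc rt (branch-⊇ br) ¬obs
      (λ b b∈ → subst Uc (sym (mapAtom-∘ b))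
        (branch-into-Uc br (λ p → ¬prod λ a a∈ → ∈-++⁺ˡ (p a a∈)) (ld b b∈)))
      (λ p → ¬prod λ a a∈ → ∈-++⁺ʳ F (p a a∈)) a∈out

    obsolete-pullback : ∀ {F} → Branch R hc D F → ¬ Produces F →
      Obsolete (listSet F) (trig (trule tr) (G ∘ tsub tr)) → Obsolete Uc tr
    obsolete-pullback {F} br ¬prod (j , σ , agree , hd) = j , σ′ , σ′-body , λ b b∈ →
      subst Uc (trans (sym (mapAtom-∘ b)) (mapAtom-cong b (λ x∈ → σ′-head (headVar (trule tr) j b∈ x∈))))
        (branch-into-Uc br ¬prod (hd b b∈))
      where
      σ′ : Subst
      -- `H` inverts `G` only on the skeleton, which may miss body variables outside the frontier.
      -- The original values are therefore kept on the whole body.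
      σ′ x with x ∈ⱽ? bodyVars (trule tr)
      ... | yes _ = tsub tr x
      ... | no _  = H (σ x)
      σ′-body : ∀ x → x ∈ bodyVars (trule tr) → σ′ x ≡ tsub tr x
      σ′-body x x∈ with x ∈ⱽ? bodyVars (trule tr)
      ... | yes _ = refl
      ... | no x∉ = contradiction x∈ x∉
      σ′-head : ∀ {x} → x ∈ allHeadVars (trule tr) → H (σ x) ≡ σ′ x
      σ′-head {x} x∈h with x ∈ⱽ? bodyVars (trule tr)
      ... | yes x∈ = trans (cong H (agree x x∈))
        (H-G (skel-frontier tr (frontier⁺ (trule tr) x∈ x∈h) (overSk (tr-proper x∈))))
      ... | no _   = refl

    unblockable : ∀ {F} → Branch R hc D F → Model R F → trule tr ∈ R →
      Loaded (listSet F) (trig (trule tr) (G ∘ tsub tr)) → UcUnblockable R hc tr → Produces F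
    unblockable br sat ψ∈ ld (inj₁ dl) a a∈ with out⁻ (trule tr) (hc (trule tr)) (tsub tr) a∈
    ... | b , b∈ , refl = subst (_∈ _)
      (trans (mapAtom-cong b λ x∈ → cong G (sym (skSubst-body (trule tr) (hc (trule tr)) (tsub tr)
          (proj₂ dl _ (headVar (trule tr) (hc (trule tr)) b∈ x∈)))))
        (mapAtom-∘ b))
      (datalog-closed sat ψ∈ dl ld (hc (trule tr)) b∈)
    unblockable {F} br sat ψ∈ ld (inj₂ ¬obs) = decidable-stable produces? λ ¬prod →
      ¬obs (obsolete-pullback br ¬prod (sat _ ψ∈ ld))
      where
      produces? : Dec (Produces F)
      produces? = map′ (λ p _ → All.lookup p) (λ p → All.tabulate (p _))
        (All.all? (λ a → mapAtom G a ∈ᶠ? F) (outHC hc tr))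

-- The terms of RPC

-- If the frontier had only constant values, sending the existential variables to the special
-- constant would give a head instance over critical constants, and the trigger would be obsolete
-- for `O`.
unblockable⇒functional : ∀ {R hc tr v} → RTrigger R tr → UcUnblockable R hc tr →
  v ∈ allHeadVars (trule tr) → v ∉ bodyVars (trule tr) →
  ∃[ x ] x ∈ frontier (trule tr) × ¬ IsConst (tsub tr x)
unblockable⇒functional _ (inj₁ (_ , dl)) v∈ v∉ = contradiction (dl _ v∈) v∉
unblockable⇒functional {R} {hc} {trig ψ μ} (ψ∈ , _) (inj₂ ¬obs) _ _
  with Any.any? (λ x → ¬? (isConst? (μ x))) (frontier ψ)
... | yes p = find p
... | no ¬p = contradiction obsolete ¬obs
  where
  σ : Subst
  σ x with x ∈ⱽ? bodyVars ψ
  ... | yes _ = μ x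
  ... | no _  = const star
  σ-body : ∀ x → x ∈ bodyVars ψ → σ x ≡ μ x
  σ-body x x∈ with x ∈ⱽ? bodyVars ψ
  ... | yes _ = refl
  ... | no x∉ = contradiction x∈ x∉
  σ-critical : ∀ {x} → x ∈ allHeadVars ψ → Critical (trig ψ μ) (σ x)
  σ-critical {x} x∈h with x ∈ⱽ? bodyVars ψ
  ... | no _   = star , refl , inj₂ refl
  ... | yes x∈ with isConst? (μ x)
  ...   | no ¬c        = contradiction (lose (frontier⁺ ψ x∈ x∈h) ¬c) ¬p
  ...   | yes (c , eq) = c , eq , inj₁ (inj₂ (x , frontier⁺ ψ x∈ x∈h , eq , c , refl))
  obsolete : Obsolete (O R hc (trig ψ μ) (Huc (trig ψ μ))) (trig ψ μ)
  obsolete = hc ψ , σ , σ-body , λ b b∈ →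
    oall-critical (head-pred σ ψ∈ (hc ψ) b∈) (λ x∈ → σ-critical (headVar ψ (hc ψ) b∈ x∈))

uc-skolem-rooted : ∀ {ρ f} → frule f ≡ ρ → Rooted ρ (app f (uc-frontier ρ))
uc-skolem-rooted {ρ} eq = rapp (λ t∈ → case ∈-map⁻ σuc t∈ of λ where
  (_ , x∈ , refl) → rvar (frontier⇒body ρ x∈)) (nhere eq)

module _ {R : List Rule} {hc : HeadChoice} {ρ : Rule} (ρ∈ : ρ ∈ R) where

  rpc-proper : ∀ {a t} → RPC R hc ρ a → t ∈ args a → Proper ρ R t
  rpc-proper (rbase a∈) t∈ with ∈-map⁻ (mapAtom σuc) a∈
  ... | b , b∈ , refl with mapAtom-args⁻ σuc b t∈
  ...   | x , x∈ , refl = proper (rvar (bodyVar ρ b∈ x∈)) oconst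
  rpc-proper (rinit a∈) t∈ with out-args ρ (hc ρ) σuc a∈ t∈
  ... | frontierTerm x∈  = proper (rvar (frontier⇒body ρ x∈)) oconst
  ... | skolemTerm v∈ v∉ = proper (uc-skolem-rooted refl)
    (oapp ρ∈ v∈ v∉ (length-map σuc (frontier ρ)) λ t t∈ → case ∈-map⁻ σuc t∈ of λ where
      (_ , _ , refl) → oconst)
  rpc-proper (rstep (trig ψ μ) rt _ ld un _ a∈) t∈ = out-proper (out-args ψ (hc ψ) μ a∈ t∈)
    where
    body-proper : ∀ {x} → x ∈ bodyVars ψ → Proper ρ R (μ x)
    body-proper x∈ with ∈-cm⁻ args (body ψ) x∈
    ... | b , b∈ , x∈b = rpc-proper (ld b b∈) (mapAtom-args⁺ μ b x∈b)
    arg-proper : ∀ {t} → t ∈ map μ (frontier ψ) → Proper ρ R t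
    arg-proper t∈ with ∈-map⁻ μ t∈
    ... | x , x∈ , refl = body-proper (frontier⇒body ψ x∈)
    -- A created term has a functional argument and inherits the initial node from it.
    new-node : ∀ {v} → v ∈ atomsVars (disjunct ψ (hc ψ)) → v ∉ bodyVars ψ →
      Node ρ (uc-frontier ρ) (app (fsym ψ (hc ψ) v) (map μ (frontier ψ)))
    new-node v∈ v∉ with unblockable⇒functional rt un (disjunctVar ψ (hc ψ) v∈) v∉
    ... | x , x∈ , ¬c with μ x | ∈-map⁺ μ x∈
    ...   | const c | _  = contradiction (c , refl) ¬c
    ...   | app _ _ | t∈ = ndeep t∈ (rooted-node ρ (rooted (arg-proper t∈)))
    out-proper : ∀ {t} → OutTerm ψ (hc ψ) μ t → Proper ρ R t
    out-proper (frontierTerm x∈)  = body-proper (frontier⇒body ψ x∈)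
    out-proper (skolemTerm v∈ v∉) = proper (rapp (λ t∈ → rooted (arg-proper t∈)) (new-node v∈ v∉))
      (oapp (proj₁ rt) v∈ v∉ (length-map μ (frontier ψ)) λ _ t∈ → overSk (arg-proper t∈))

-- Simple terms and the first repetition of `ρ`.

Simple : Rule → GTerm → Set
Simple ρ t = ∀ {us} → Node ρ us t → us ≡ uc-frontier ρ

-- The first trigger for ρ, after the initial one, in a derivation of RPC(R, hc, ρ).

record Repetition (R : List Rule) (hc : HeadChoice) (ρ : Rule) : Set where
  field
    τ           : Subst
    τ-loaded    : Loaded (RPC R hc ρ) (trig ρ τ)
    τ-injective : InjectiveOn (bodyVars ρ) τ
    τ-out       : ∀ {a} → a ∈ outHC hc (trig ρ τ) → RPC R hc ρ a
    τ-simple    : ∀ {x} → x ∈ bodyVars ρ → Simple ρ (τ x)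
    x₀          : Var
    x₀∈         : x₀ ∈ frontier ρ
    x₀-app      : ¬ IsConst (τ x₀)

collect : {P : Set} {Q : A → Set} (xs : List A) → (∀ {x} → x ∈ xs → P ⊎ Q x) → P ⊎ (∀ {x} → x ∈ xs → Q x)
collect []       f = inj₂ λ ()
collect (x ∷ xs) f with f (here refl) | collect xs (f ∘ there)
... | inj₁ p | _      = inj₁ p
... | inj₂ _ | inj₁ p = inj₁ p
... | inj₂ q | inj₂ g = inj₂ λ where
  (here refl) → q
  (there x∈)  → g x∈

const-simple : ∀ {ρ c} → Simple ρ (const c)
const-simple ()

-- The recursion looks into the body of a step before its rule is examined. The repetition returned
-- therefore has simple body values.
first-repetition : ∀ {R hc ρ a t} → RPC R hc ρ a → t ∈ args a → Repetition R hc ρ ⊎ Simple ρ t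
first-repetition (rbase a∈) t∈ with ∈-map⁻ (mapAtom σuc) a∈
... | b , _ , refl with mapAtom-args⁻ σuc b t∈
...   | _ , _ , refl = inj₂ const-simple
first-repetition {hc = hc} {ρ} (rinit a∈) t∈ with out-args ρ (hc ρ) σuc a∈ t∈
... | frontierTerm _ = inj₂ const-simple
... | skolemTerm _ _ = inj₂ λ where
  (nhere _)    → refl
  (ndeep t∈ n) → case ∈-map⁻ σuc t∈ of λ where (_ , _ , refl) → const-simple n
first-repetition {R} {hc} {ρ} (rstep (trig ψ μ) rt acyc ld un inj a∈) t∈ = from-out (out-args ψ (hc ψ) μ a∈ t∈)
  where
  from-body : ∀ {x} → x ∈ bodyVars ψ → Repetition R hc ρ ⊎ Simple ρ (μ x)
  from-body x∈ with ∈-cm⁻ args (body ψ) x∈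
  ... | b , b∈ , x∈b = first-repetition (ld b b∈) (mapAtom-args⁺ μ b x∈b)
  from-out : ∀ {t} → OutTerm ψ (hc ψ) μ t → Repetition R hc ρ ⊎ Simple ρ t
  from-out (frontierTerm x∈) = from-body (frontier⇒body ψ x∈)
  from-out (skolemTerm v∈ v∉) with collect (bodyVars ψ) from-body
  ... | inj₁ rep = inj₁ rep
  ... | inj₂ simple with ψ ≟ᴿ ρ
  ...   | no ψ≢ρ = inj₂ λ where
    (nhere eq)   → contradiction eq ψ≢ρ
    (ndeep t∈ n) → case ∈-map⁻ μ t∈ of λ where (_ , x∈ , refl) → simple (frontier⇒body ψ x∈) n
  ...   | yes refl = let x , x∈ , ¬c = unblockable⇒functional rt un (disjunctVar ψ (hc ψ) v∈) v∉ in inj₁ record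
    { τ           = μ
    ; τ-loaded    = ld
    ; τ-injective = inj refl
    ; τ-out       = rstep (trig ψ μ) rt acyc ld un inj
    ; τ-simple    = simple
    ; x₀          = x
    ; x₀∈         = x∈
    ; x₀-app      = ¬c
    }

-- In a simple term a symbol of `ρ` has only constants as arguments, so it cannot recur below
-- itself.
cyclic⇒repetition : ∀ {R hc ρ t} → RhoCyclic ρ t → OccursIn t (RPC R hc ρ) → Repetition R hc ρ
cyclic⇒repetition (f , ss , refl , refl , s , s∈ , occ) (a , ra , t∈) with first-repetition ra t∈
... | inj₁ rep    = rep
... | inj₂ simple with simple (nhere refl)
...   | refl with ∈-map⁻ σuc s∈
cyclic⇒repetition (f , ss , refl , refl , s , s∈ , ()) (a , ra , t∈) | inj₂ simple | refl | _ , _ , refl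

-- The embeddings of RPC terms into a chase

map-inj-on : {f : A → B} (xs ys : List A) → (∀ {x y} → x ∈ xs → y ∈ ys → f x ≡ f y → x ≡ y) →
  map f xs ≡ map f ys → xs ≡ ys
map-inj-on []       []       _   _  = refl
map-inj-on (x ∷ xs) (y ∷ ys) inj eq with ∷-injective eq
... | hd , tl = cong₂ _∷_ (inj (here refl) (here refl) hd)
  (map-inj-on xs ys (λ x∈ y∈ → inj (there x∈) (there y∈)) tl)

map-≡⁻ : {f g : A → B} {xs : List A} → map f xs ≡ map g xs → ∀ {x} → x ∈ xs → f x ≡ g x
map-≡⁻ {xs = _ ∷ _} eq (here refl) = proj₁ (∷-injective eq)
map-≡⁻ {xs = _ ∷ _} eq (there x∈)  = map-≡⁻ (proj₂ (∷-injective eq)) x∈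

hom  : Subst → GTerm → GTerm
homs : Subst → List GTerm → List GTerm
hom θ (const (cvar x)) = θ x
hom θ (const c)        = const c
hom θ (app f ts)       = app f (homs θ ts)
homs θ []       = []
homs θ (t ∷ ts) = hom θ t ∷ homs θ ts

homs-map : ∀ θ ts → homs θ ts ≡ map (hom θ) ts
homs-map θ []       = refl
homs-map θ (t ∷ ts) = cong (hom θ t ∷_) (homs-map θ ts)

hom-app : ∀ θ f ts → hom θ (app f ts) ≡ app f (map (hom θ) ts)
hom-app θ f ts = cong (app f) (homs-map θ ts)

hom-node : ∀ {χ θ ss t} → Node χ ss t → Node χ (map (hom θ) ss) (hom θ t)
hom-node {θ = θ} (nhere {f} eq) = subst (Node _ _) (sym (hom-app θ f _)) (nhere eq)
hom-node {θ = θ} (ndeep {f} t∈ n) = subst (Node _ _) (sym (hom-app θ f _)) (ndeep (∈-map⁺ (hom θ) t∈) (hom-node n))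

hom-rooted : ∀ {ρ θ f ts} → Rooted ρ (app f ts) → Node ρ (map θ (frontier ρ)) (hom θ (app f ts))
hom-rooted {ρ} r = subst (λ us → Node ρ us _) (sym (map-∘ (frontier ρ))) (hom-node (rooted-node ρ r))

node-replace : ∀ {χ ss f us w} → Node χ ss (app f us) → Node (frule f) us w → Node χ ss w
node-replace (nhere refl) m = m
node-replace (ndeep t∈ n) m = node-arg m t∈ n

-- Every functional rooted term contains a node of the initial trigger, whose `hom θ`-image is a
-- node over the `θ`-values of the frontier. Since no value of `θ` contains such a node, images of
-- functional terms differ from images of constants.
record Independent (ρ : Rule) (θ : Subst) : Set where
  field
    θ-injective : InjectiveOn (bodyVars ρ) θ
    θ-no-node   : ∀ {x} → x ∈ bodyVars ρ → ¬ Node ρ (map θ (frontier ρ)) (θ x)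

module Hom {ρ θ} (ind : Independent ρ θ) where
  open Independent ind

  hom-inj : ∀ {s t} → Rooted ρ s → Rooted ρ t → hom θ s ≡ hom θ t → s ≡ t
  hom-inj (rvar x∈) (rvar y∈) eq = cong (λ z → const (cvar z)) (θ-injective _ _ x∈ y∈ eq)
  hom-inj (rvar x∈) r@(rapp _ _) eq = contradiction (subst (Node ρ _) (sym eq) (hom-rooted r)) (θ-no-node x∈)
  hom-inj r@(rapp _ _) (rvar y∈) eq = contradiction (subst (Node ρ _) eq (hom-rooted r)) (θ-no-node y∈)
  hom-inj (rapp {f} {ts} rs _) (rapp {g} {us} rs′ _) eq
    with app-inj (trans (sym (hom-app θ f ts)) (trans eq (hom-app θ g us)))
  ... | refl , eqs = cong (app f) (map-inj-on ts us (λ s∈ t∈ → hom-inj (rs s∈) (rs′ t∈)) eqs)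

  -- Some term created by the same trigger as `u` occurs in `w`.
  Sibling : GTerm → GTerm → Set
  Sibling (const _)  w = ⊥
  Sibling (app f us) w = Node (frule f) us w

  S : GTerm → Set
  S u = IsConst u ⊎ Any (λ x → Sibling u (θ x)) (bodyVars ρ)

  hom-reversible : ∀ {R hc D} → Reversible R hc ρ D (hom θ) S
  hom-reversible = record
    { S?        = S?
    ; S-sibling = λ where
        eq (inj₁ (_ , ()))
        refl (inj₂ p) → inj₂ p
    ; S-arg     = S-arg
    ; S-const   = S-const
    ; G-inj     = hom-inj
    ; G-unapp   = unapp
    ; G-app     = λ _ _ eqs → trans (hom-app θ _ _) (cong (app _) eqs)
    }
    where
    S? : Decidable S
    S? (const c)  = yes (inj₁ (c , refl))
    S? (app f us) = map′ inj₂ (λ { (inj₂ p) → p })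
      (Any.any? (λ x → node? (frule f) us (θ x)) (bodyVars ρ))
    S-arg : ∀ {f us u} → S (app f us) → u ∈ us → S u
    S-arg {u = const c}  _        _  = inj₁ (c , refl)
    S-arg {u = app g ts} (inj₂ p) u∈ = inj₂ (Any.map (λ n → node-arg n u∈ (nhere refl)) p)
    S-const : ∀ {s} → Rooted ρ s → S (hom θ s) → IsConst s
    S-const (rvar _)       _        = _ , refl
    S-const r@(rapp _ _) (inj₂ p) =
      let x , x∈ , n = find p in contradiction (node-replace (hom-rooted r) n) (θ-no-node x∈)
    unapp : ∀ {s f us} → Rooted ρ s → hom θ s ≡ app f us →
      (∃[ ss ] s ≡ app f ss × map (hom θ) ss ≡ us) ⊎ S (app f us)
    unapp (rvar x∈) eq = inj₂ (inj₂ (lose x∈ (subst (Node _ _) (sym eq) (nhere refl))))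
    unapp (rapp {f} {ts} _ _) eq with app-inj (trans (sym (hom-app θ f ts)) eq)
    ... | refl , eqs = inj₁ (ts , refl , eqs)

  hom-simple-node : ∀ {t us} → Rooted ρ t → Simple ρ t → Node ρ us (hom θ t) →
    us ≡ map θ (frontier ρ) ⊎ ∃[ y ] y ∈ bodyVars ρ × Node ρ us (θ y)
  hom-simple-node (rvar x∈) _ n = inj₂ (_ , x∈ , n)
  hom-simple-node (rapp {f} {ts} rs _) simple n with subst (Node ρ _) (hom-app θ f ts) n
  ... | nhere eq with simple (nhere eq)
  ...   | refl = inj₁ (sym (map-∘ (frontier ρ)))
  hom-simple-node (rapp {f} {ts} rs _) simple n | ndeep u∈ m with ∈-map⁻ (hom θ) u∈
  ... | t , t∈ , refl = hom-simple-node (rs t∈) (λ m′ → simple (ndeep t∈ m′)) m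

-- π turns the outputs of the initial trigger into constants, as needed for a database.

module Initial (ρ : Rule) where

  Base : FSym → List GTerm → Set
  Base f ts = frule f ≡ ρ × ts ≡ uc-frontier ρ

  base? : ∀ f ts → Dec (Base f ts)
  base? f ts = (frule f ≟ᴿ ρ) ×-dec (≡-dec _≟ᵀ_ ts (uc-frontier ρ))

  π  : GTerm → GTerm
  πs : List GTerm → List GTerm
  π (const c)  = const c
  π (app f ts) with base? f ts
  ... | yes _ = const (cfun f)
  ... | no _  = app f (πs ts)
  πs []       = []
  πs (t ∷ ts) = π t ∷ πs ts

  πs-map : ∀ ts → πs ts ≡ map π ts
  πs-map []       = refl
  πs-map (t ∷ ts) = cong (π t ∷_) (πs-map ts)

  π-base : ∀ {f ts} → Base f ts → π (app f ts) ≡ const (cfun f)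
  π-base {f} {ts} b with base? f ts
  ... | yes _ = refl
  ... | no ¬b = contradiction b ¬b

  π-app : ∀ {f ts} → ¬ Base f ts → π (app f ts) ≡ app f (map π ts)
  π-app {f} {ts} ¬b with base? f ts
  ... | yes b = contradiction b ¬b
  ... | no _  = cong (app f) (πs-map ts)

  data π-View (f : FSym) (ts : List GTerm) : GTerm → Set where
    isBase  : Base f ts → π-View f ts (const (cfun f))
    notBase : ¬ Base f ts → π-View f ts (app f (map π ts))

  π-view : ∀ f ts → π-View f ts (π (app f ts))
  π-view f ts with base? f ts
  ... | yes b = isBase b
  ... | no ¬b = subst (λ us → π-View f ts (app f us)) (sym (πs-map ts)) (notBase ¬b)

  π-app≢cvar : ∀ {f ts x} → π (app f ts) ≢ const (cvar x)
  π-app≢cvar {f} {ts} eq with π (app f ts) | π-view f ts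
  π-app≢cvar () | _ | isBase _
  π-app≢cvar () | _ | notBase _

  π-inj : ∀ {s t} → Rooted ρ s → Rooted ρ t → π s ≡ π t → s ≡ t
  π-inj (rvar _)   (rvar _)   eq = eq
  π-inj (rvar _)   (rapp _ _) eq = contradiction (sym eq) π-app≢cvar
  π-inj (rapp _ _) (rvar _)   eq = contradiction eq π-app≢cvar
  π-inj (rapp {f} {ts} rs _) (rapp {g} {us} rs′ _) eq
    with π (app f ts) | π-view f ts | π (app g us) | π-view g us
  π-inj (rapp rs _) (rapp rs′ _) refl | _ | isBase (_ , refl) | _ | isBase (_ , refl) = refl
  π-inj (rapp rs _) (rapp rs′ _) ()   | _ | isBase _  | _ | notBase _
  π-inj (rapp rs _) (rapp rs′ _) ()   | _ | notBase _ | _ | isBase _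
  π-inj (rapp {f} {ts} rs _) (rapp {g} {us} rs′ _) eq | _ | notBase _ | _ | notBase _ with app-inj eq
  ... | refl , eqs = cong (app f) (map-inj-on ts us (λ s∈ t∈ → π-inj (rs s∈) (rs′ t∈)) eqs)

  π-unapp : ∀ {s f us} → Rooted ρ s → π s ≡ app f us → ∃[ ss ] s ≡ app f ss × map π ss ≡ us
  π-unapp (rapp {f} {ts} _ _) eq with π (app f ts) | π-view f ts
  π-unapp (rapp {f} {ts} _ _) refl | _ | notBase _ = ts , refl , refl

  -- In a simple term every `ρ`-node is an output of the initial trigger, and `π` turns exactly
  -- these into constants.
  π-simple-node : ∀ {t us} → Rooted ρ t → Simple ρ t → ¬ Node ρ us (π t)
  π-simple-node (rapp {f} {ts} rs _) simple n with π (app f ts) | π-view f ts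
  π-simple-node (rapp {f} {ts} rs _) simple () | _ | isBase _
  π-simple-node (rapp {f} {ts} rs _) simple (nhere eq) | _ | notBase ¬b =
    contradiction (eq , simple (nhere eq)) ¬b
  π-simple-node (rapp {f} {ts} rs _) simple (ndeep u∈ n) | _ | notBase _ with ∈-map⁻ π u∈
  ... | t , t∈ , refl = π-simple-node (rs t∈) (λ m → simple (ndeep t∈ m)) n

  module _ (hc : HeadChoice) where

    db : Database
    db = Dρ ρ ++ map (mapAtom π) (outHC hc (trig ρ σuc))

    uc-sk : Subst
    uc-sk = skSubst ρ (hc ρ) σuc

    db-out : ∀ {b} → b ∈ disjunct ρ (hc ρ) → mapAtom π (mapAtom uc-sk b) ∈ db
    db-out b∈ = ∈-++⁺ʳ (Dρ ρ) (∈-map⁺ (mapAtom π) (out⁺ ρ (hc ρ) σuc b∈))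

    π-exist : ∀ {x} → x ∉ bodyVars ρ → π (uc-sk x) ≡ const (cfun (fsym ρ (hc ρ) x))
    π-exist x∉ = trans (cong π (skSubst-exist ρ (hc ρ) σuc x∉)) (π-base (refl , refl))

    π-body : ∀ {x} → x ∈ bodyVars ρ → π (uc-sk x) ≡ const (cvar x)
    π-body x∈ = cong π (skSubst-body ρ (hc ρ) σuc x∈)

    data DbFact : Fact → Set where
      from-body : ∀ {b} → b ∈ body ρ → DbFact (mapAtom σuc b)
      from-head : ∀ {b} → b ∈ disjunct ρ (hc ρ) → DbFact (mapAtom (π ∘ uc-sk) b)

    dbFact : ∀ {a} → a ∈ db → DbFact a
    dbFact a∈ with ∈-++⁻ (Dρ ρ) a∈
    ... | inj₁ a∈D with ∈-map⁻ (mapAtom σuc) a∈D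
    ...   | b , b∈ , refl = from-body b∈
    dbFact a∈ | inj₂ a∈π with ∈-map⁻ (mapAtom π) a∈π
    ... | _ , a∈out , refl with out⁻ ρ (hc ρ) σuc a∈out
    ...   | b , b∈ , refl = subst DbFact (mapAtom-∘ b) (from-head b∈)

    π-uc-const : ∀ x → IsConst (π (uc-sk x))
    π-uc-const x with x ∈ⱽ? bodyVars ρ | π-body {x} | π-exist {x}
    ... | yes x∈ | eq | _  = _ , eq x∈
    ... | no x∉  | _  | eq = _ , eq x∉

    db-const : IsDatabase db
    db-const a a∈ t t∈ with dbFact a∈
    ... | from-body {b} _ with mapAtom-args⁻ σuc b t∈
    ...   | x , _ , refl = _ , refl
    db-const a a∈ t t∈ | from-head {b} _ with mapAtom-args⁻ (π ∘ uc-sk) b t∈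
    ...   | x , _ , refl = π-uc-const x

    -- The constants in the database already witness the existential variables, so the chase never
    -- creates the terms that `π` erases.
    uc-trigger-obsolete : ∀ {F : List Fact} {υ} → (∀ {a} → a ∈ db → a ∈ F) →
      map υ (frontier ρ) ≡ map σuc (frontier ρ) → Obsolete (listSet F) (trig ρ υ)
    uc-trigger-obsolete {F} {υ} db⊆F eqs = hc ρ , σ , σ-body , λ b b∈ →
      subst (_∈ F) (trans (sym (mapAtom-∘ b)) (mapAtom-cong b λ x∈ → σ-head (headVar ρ (hc ρ) b∈ x∈)))
        (db⊆F (db-out b∈))
      where
      σ : Subst
      σ x with x ∈ⱽ? bodyVars ρ
      ... | yes _ = υ x
      ... | no _  = const (cfun (fsym ρ (hc ρ) x))
      σ-body : ∀ x → x ∈ bodyVars ρ → σ x ≡ υ x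
      σ-body x x∈ with x ∈ⱽ? bodyVars ρ
      ... | yes _ = refl
      ... | no x∉ = contradiction x∈ x∉
      σ-head : ∀ {x} → x ∈ allHeadVars ρ → π (uc-sk x) ≡ σ x
      σ-head {x} x∈h with x ∈ⱽ? bodyVars ρ | π-exist {x}
      ... | yes x∈ | _  = sym (map-≡⁻ eqs (frontier⁺ ρ x∈ x∈h))
      ... | no x∉  | eq = π-base (refl , refl)

    π-reversible : ∀ {R} → Reversible R hc ρ db π (λ _ → ⊥)
    π-reversible = record
      { S?        = λ _ → no λ ()
      ; S-sibling = λ _ ()
      ; S-arg     = λ ()
      ; S-const   = λ _ ()
      ; G-inj     = π-inj
      ; G-unapp   = λ r eq → inj₁ (π-unapp r eq)
      ; G-app     = π-app-applied
      }
      where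
      π-app-applied : ∀ {F χ υ ss v} → (∀ {a} → a ∈ db → a ∈ F) → ¬ Obsolete (listSet F) (trig χ υ) →
        map π ss ≡ map υ (frontier χ) →
        π (app (fsym χ (hc χ) v) ss) ≡ app (fsym χ (hc χ) v) (map υ (frontier χ))
      π-app-applied {χ = χ} {υ} {ss} {v} db⊆F ¬obs eqs
        with π (app (fsym χ (hc χ) v) ss) | π-view (fsym χ (hc χ) v) ss
      ... | _ | notBase _            = cong (app _) eqs
      ... | _ | isBase (refl , refl) =
        contradiction (uc-trigger-obsolete db⊆F (trans (sym eqs) (sym (map-∘ (frontier ρ))))) ¬obs

-- Embedding RPC into the model at the end of a branch.

module _ {R : List Rule} {hc : HeadChoice} {ρ : Rule} (ρ∈ : ρ ∈ R) where

  open Initial ρ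

  D : Database
  D = db hc

  db-pullback : ∀ {tr h} {H : GTerm → GTerm} {a} → DbFact hc a → (∀ {t} → t ∈ args a → Critical tr (H t)) →
    O R hc tr h (mapAtom H a)
  db-pullback {H = H} (from-body {b} b∈) crit = subst (O _ _ _ _) (mapAtom-∘ b)
    (oall-critical (body-pred (H ∘ σuc) ρ∈ b∈) λ x∈ → crit (mapAtom-args⁺ σuc b x∈))
  db-pullback {H = H} (from-head {b} b∈) crit = subst (O _ _ _ _) (mapAtom-∘ b)
    (oall-critical (head-pred (H ∘ π ∘ uc-sk hc) ρ∈ (hc ρ) b∈) λ x∈ → crit (mapAtom-args⁺ (π ∘ uc-sk hc) b x∈))

  module _ {F : List Fact} (br : Branch R hc D F) (sat : Model R F) where

    Embeds : (GTerm → GTerm) → Set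
    Embeds G = ∀ {a} → RPC R hc ρ a → mapAtom G a ∈ F

    -- The database has to be pulled back into each `O`, and the initial facts have to be mapped
    -- into `F`; later steps follow by induction on the derivation.
    module _ {G S} (rev : Reversible R hc ρ D G S)
      (base : ∀ tr (p : ∀ {x} → x ∈ bodyVars (trule tr) → Proper ρ R (tsub tr x))
                   (o : ∀ {a t} → a ∈ outHC hc tr → t ∈ args a → Rooted ρ t) →
              ∀ {a} → a ∈ D → O R hc tr (Huc tr) (mapAtom (Pullback.H rev tr p o) a))
      (body-in : ∀ {b} → b ∈ body ρ → mapAtom G (mapAtom σuc b) ∈ F)
      (head-in : ∀ {b} → b ∈ disjunct ρ (hc ρ) → mapAtom G (mapAtom (uc-sk hc) b) ∈ F) where

      embeds : Embeds G
      embeds (rbase a∈) with ∈-map⁻ (mapAtom σuc) a∈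
      ... | b , b∈ , refl = body-in b∈
      embeds (rinit a∈) with out⁻ ρ (hc ρ) σuc a∈
      ... | b , b∈ , refl = head-in b∈
      embeds (rstep (trig ψ μ) rt acyc ld un inj a∈) =
        Pullback.unblockable rev (trig ψ μ) p o (base (trig ψ μ) p o) br sat (proj₁ rt) G-ld un _ a∈
        where
        p : ∀ {x} → x ∈ bodyVars ψ → Proper ρ R (μ x)
        p = loaded-arg {RPC R hc ρ} {Proper ρ R} (trig ψ μ) (λ {a} → rpc-proper ρ∈ {a}) ld
        o : ∀ {a t} → a ∈ outHC hc (trig ψ μ) → t ∈ args a → Rooted ρ t
        o a∈ t∈ = rooted (rpc-proper ρ∈ (rstep (trig ψ μ) rt acyc ld un inj a∈) t∈)
        G-ld : Loaded (listSet F) (trig ψ (G ∘ μ))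
        G-ld b b∈ = subst (_∈ F) (sym (mapAtom-∘ b)) (embeds (ld b b∈))

    π-embeds : Embeds π
    π-embeds = embeds (π-reversible hc) base body-in head-in
      where
      body-in : ∀ {b} → b ∈ body ρ → mapAtom π (mapAtom σuc b) ∈ F
      body-in {b} b∈ = subst (_∈ F) (mapAtom-∘ b) (branch-⊇ br (∈-++⁺ˡ (∈-map⁺ (mapAtom σuc) b∈)))
      head-in : ∀ {b} → b ∈ disjunct ρ (hc ρ) → mapAtom π (mapAtom (uc-sk hc) b) ∈ F
      head-in b∈ = branch-⊇ br (db-out hc b∈)
      base : ∀ tr (p : ∀ {x} → x ∈ bodyVars (trule tr) → Proper ρ R (tsub tr x))
                  (o : ∀ {a t} → a ∈ outHC hc tr → t ∈ args a → Rooted ρ t) →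
             ∀ {a} → a ∈ D → O R hc tr (Huc tr) (mapAtom (Pullback.H (π-reversible hc) tr p o) a)
      base tr p o a∈ = by-fact (dbFact hc a∈)
        where
        open Pullback (π-reversible hc) tr p o
        H-cvar : ∀ x → Critical tr (H (const (cvar x)))
        H-cvar x with collapse (const (cvar x))
        ... | _ , shared _ _      = star , refl , inj₂ refl
        ... | _ , fresh () _ _
        ... | _ , preimage s eq with skel⇒rooted s
        ...   | rvar _   = _ , refl , inj₁ s
        ...   | rapp _ _ = contradiction eq π-app≢cvar
        H-cfun : ∀ {f} → frule f ≡ ρ → ¬ Skel tr (app f (uc-frontier ρ)) → Critical tr (H (const (cfun f)))
        H-cfun {f} eq ¬s with collapse (const (cfun f))
        ... | _ , shared _ _      = star , refl , inj₂ refl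
        ... | _ , fresh () _ _
        ... | _ , preimage s eq′
          with π-inj (skel⇒rooted s) (uc-skolem-rooted eq) (trans eq′ (sym (π-base (eq , refl))))
        ...   | refl = contradiction s ¬s
        -- If the skolem term behind some `cfun f` of a head fact lies in the skeleton, the fact
        -- pulls back to a birth fact. Otherwise that constant has no preimage and goes to the
        -- special constant.
        BornVar : Var → Set
        BornVar v = v ∉ bodyVars ρ × app (fsym ρ (hc ρ) v) (uc-frontier ρ) ∈ skelList tr
        bornVar? : Decidable BornVar
        bornVar? v = ¬? (v ∈ⱽ? bodyVars ρ) ×-dec (_ ∈ᵀ? skelList tr)
        from-birth : ∀ {v b} → Skel tr (app (fsym ρ (hc ρ) v) (uc-frontier ρ)) → b ∈ disjunct ρ (hc ρ) →
          Uc (mapAtom H (mapAtom (π ∘ uc-sk hc) b))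
        from-birth {b = b} s b∈ = subst Uc
          (trans (mapAtom-cong b λ x∈ → sym (H-G (inj₁ (_ , bt , mapAtom-args⁺ (uc-sk hc) b x∈)))) (mapAtom-∘ b))
          (obirth bt)
          where
          bt : BirthT tr (mapAtom (uc-sk hc) b)
          bt = skel-birth tr s (own (out-cong ρ (hc ρ)
            (λ x∈ → sym (assign-map (frontier ρ) σuc x∈)) (out⁺ ρ (hc ρ) σuc b∈)))
        by-fact : ∀ {a} → DbFact hc a → Uc (mapAtom H a)
        by-fact (from-body {b} b∈) = db-pullback (from-body b∈) λ t∈ →
          case mapAtom-args⁻ σuc b t∈ of λ where (x , _ , refl) → H-cvar x
        by-fact (from-head {b} b∈) with Any.any? bornVar? (args b)
        ... | yes q = let v , _ , _ , s∈ = find q in from-birth (skelList⁻ tr s∈) b∈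
        ... | no ¬q = db-pullback (from-head b∈) λ t∈ →
          case mapAtom-args⁻ (π ∘ uc-sk hc) b t∈ of λ where (x , x∈ , refl) → critical x∈
          where
          critical : ∀ {x} → x ∈ args b → Critical tr (H (π (uc-sk hc x)))
          critical {x} x∈ with x ∈ⱽ? bodyVars ρ | π-body hc {x} | π-exist hc {x}
          ... | yes x∈b | eq | _  = subst (Critical tr ∘ H) (sym (eq x∈b)) (H-cvar x)
          ... | no x∉   | _  | eq = subst (Critical tr ∘ H) (sym (eq x∉))
            (H-cfun refl λ s → ¬q (lose x∈ (x∉ , skelList⁺ tr s)))

    -- Iterating the repetition to unbounded term size.

    module _ (rep : Repetition R hc ρ) where

      open Repetition rep

      τ-rooted : ∀ {x} → x ∈ bodyVars ρ → Rooted ρ (τ x)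
      τ-rooted x∈ = rooted (loaded-arg {RPC R hc ρ} {Proper ρ R} (trig ρ τ) (λ {a} → rpc-proper ρ∈ {a}) τ-loaded x∈)

      x₀∈body : x₀ ∈ bodyVars ρ
      x₀∈body = frontier⇒body ρ x₀∈

      -- The body and output facts of `trig ρ τ` lie in RPC, and their `G`-images are the images of
      -- the initial facts under the new homomorphism.
      extend : ∀ {G} → Independent ρ (G ∘ τ) → Embeds G →
        (∀ {f} → frule f ≡ ρ → G (app f (map τ (frontier ρ))) ≡ app f (map (G ∘ τ) (frontier ρ))) →
        Embeds (hom (G ∘ τ))
      extend {G} ind emb G-τ = embeds hom-reversible base body-in head-in
        where
        open Hom ind
        base : ∀ tr (p : ∀ {x} → x ∈ bodyVars (trule tr) → Proper ρ R (tsub tr x))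
                    (o : ∀ {a t} → a ∈ outHC hc tr → t ∈ args a → Rooted ρ t) →
               ∀ {a} → a ∈ D → O R hc tr (Huc tr) (mapAtom (Pullback.H hom-reversible tr p o) a)
        base tr p o {a} a∈ = db-pullback (dbFact hc a∈) λ t∈ →
          H-shared (inj₁ (db-const hc a a∈ _ t∈))
          where open Pullback (hom-reversible {R} {hc} {D}) tr p o
        body-in : ∀ {b} → b ∈ body ρ → mapAtom (hom (G ∘ τ)) (mapAtom σuc b) ∈ F
        body-in {b} b∈ = subst (_∈ F) (trans (sym (mapAtom-∘ b)) (mapAtom-∘ b)) (emb (τ-loaded b b∈))
        hom-sk : ∀ {x} → G (skSubst ρ (hc ρ) τ x) ≡ hom (G ∘ τ) (uc-sk hc x)
        hom-sk {x} with x ∈ⱽ? bodyVars ρ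
        ... | yes _ = refl
        ... | no _  = trans (G-τ refl) (trans (cong (app _) (map-∘ (frontier ρ))) (sym (hom-app (G ∘ τ) _ _)))
        head-in : ∀ {b} → b ∈ disjunct ρ (hc ρ) → mapAtom (hom (G ∘ τ)) (mapAtom (uc-sk hc) b) ∈ F
        head-in {b} b∈ = subst (_∈ F)
          (trans (sym (mapAtom-∘ b)) (trans (mapAtom-cong b (λ _ → hom-sk)) (mapAtom-∘ b)))
          (emb (τ-out (out⁺ ρ (hc ρ) τ b∈)))

      θs : ℕ → Subst
      θs zero    = π ∘ τ
      θs (suc k) = hom (θs k) ∘ τ

      x₀-node : ∀ θ → Node ρ (map θ (frontier ρ)) (hom θ (τ x₀))
      x₀-node θ with τ x₀ | x₀-app | τ-rooted x₀∈body
      ... | const c  | ¬c | _ = contradiction (c , refl) ¬c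
      ... | app f ts | _  | r = hom-rooted r

      θs-independent : ∀ k → Independent ρ (θs k)
      θs-independent zero = record
        { θ-injective = λ x y x∈ y∈ eq → τ-injective x y x∈ y∈ (π-inj (τ-rooted x∈) (τ-rooted y∈) eq)
        ; θ-no-node   = λ x∈ → π-simple-node (τ-rooted x∈) (τ-simple x∈)
        }
      θs-independent (suc k) = record
        { θ-injective = λ x y x∈ y∈ eq → τ-injective x y x∈ y∈ (hom-inj (τ-rooted x∈) (τ-rooted y∈) eq)
        ; θ-no-node   = λ x∈ n → no-node (hom-simple-node (τ-rooted x∈) (τ-simple x∈) n)
        }
        where
        ind : Independent ρ (θs k)
        ind = θs-independent k
        open Independent ind
        open Hom ind
        no-node : map (θs (suc k)) (frontier ρ) ≡ map (θs k) (frontier ρ)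
          ⊎ (∃[ y ] y ∈ bodyVars ρ × Node ρ (map (θs (suc k)) (frontier ρ)) (θs k y)) → ⊥
        -- Equality at `x₀` says that `hom (θs k)` identifies `τ x₀` with the constant of `x₀`;
        -- injectivity would make `τ x₀` constant.
        no-node (inj₁ eqs) = x₀-app (_ , hom-inj (τ-rooted x₀∈body) (rvar x₀∈body) (map-≡⁻ eqs x₀∈))
        -- The node has `θs (suc k) x₀` as an argument, which contains a node over the values of
        -- `θs k`; this node would then occur in `θs k y`.
        no-node (inj₂ (y , y∈ , n)) = θ-no-node y∈ (node-arg n (∈-map⁺ (θs (suc k)) x₀∈) (x₀-node (θs k)))

      θs-embeds : ∀ k → Embeds (hom (θs k))
      θs-embeds zero    = extend (θs-independent zero) π-embeds λ {f} _ →
        trans (π-app (¬base {f})) (cong (app _) (sym (map-∘ (frontier ρ))))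
        where
        ¬base : ∀ {f} → ¬ Base f (map τ (frontier ρ))
        ¬base (_ , eqs) = x₀-app (_ , map-≡⁻ eqs x₀∈)
      θs-embeds (suc k) = extend (θs-independent (suc k)) (θs-embeds k) λ _ →
        trans (hom-app (θs k) _ _) (cong (app _) (sym (map-∘ (frontier ρ))))

      -- Each value at `x₀` is an argument of a node inside the next one, so sizes grow strictly.
      θs-size : ∀ k → k ≤ size (θs k x₀)
      θs-size zero    = z≤n
      θs-size (suc k) = ≤-<-trans (θs-size k) (node-size (∈-map⁺ (θs k) x₀∈) (x₀-node (θs k)))

      bound : ℕ
      bound = sum (map size (concatMap args F))

      θs-bounded : ∀ k → size (θs k x₀) ≤ bound
      -- As `x₀` occurs in the body, its constant occurs in the initial facts, and `θs k x₀` in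
      -- their image in `F`.
      θs-bounded k with ∈-cm⁻ args (body ρ) x₀∈body
      ... | b , b∈ , x₀∈b = ∈⇒≤sum (∈-map⁺ size (∈-cm⁺ args
        (θs-embeds k (rbase (∈-map⁺ (mapAtom σuc) b∈)))
        (mapAtom-args⁺ (hom (θs k)) (mapAtom σuc b) (mapAtom-args⁺ σuc b x₀∈b))))

      no-model : ⊥
      no-model = <-irrefl refl (≤-trans (θs-size (suc bound)) (θs-bounded (suc bound)))

theorem5 : (R : List Rule) → RPCs R → NeverTerminates R
theorem5 R (i , _ , _ , ρ , ρ∈ , t , cyc , occ) = db hc , db-const hc , λ tree →
  let F , br , sat = finite-tree⇒model tree (root {hc = hc})
  in no-model ρ∈ br sat (cyclic⇒repetition cyc occ)
  where
  open Initial ρ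
  hc : HeadChoice
  hc = hcᵢ i
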